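{- For any positive integers $r$ and $h$ and any real $\varepsilon>0$, there are infinitely many graphs $G$ that satisfy $iso(G\setminus S)\le \frac{1}{h}|S|$ for all $S\subseteq V(G)$, are $\big(\frac{5}{3}+\frac{1}{18r}-\varepsilon\big)$-tough, and have no connected $\{2,4,\ldots,2r\}$-factor.
   Context: Graphs are finite, have no loops, but may have multiple edges; degrees count multiplicities. For $S\subseteq V(G)$, $G\setminus S$ is the graph obtained by deleting $S$; $\omega(\cdot)$ is the number of connected components and $iso(\cdot)$ the number of isolated vertices. A graph is $t$-tough ($t>0$ real) if $\omega(G\setminus S)\le\max\{1,|S|/t\}$ for all $S\subseteq V(G)$. For a set $A$ of integers, an $A$-factor is a spanning subgraph all of whose vertex degrees lie in $A$. -}

module Defs where

import Algebra.Properties.CommutativeMonoid.Sum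
open import Data.Fin.Base using (Fin; zero; suc)
open import Data.Fin.Properties using (any?)
import Data.Fin.Properties as Fin
open import Data.Fin.Subset using (Subset; _∉_; ∣_∣)
open import Data.Fin.Subset.Properties using (_∈?_)
open import Data.Integer.Base using (ℤ; +_)
open import Data.List.Base using (List; []; _∷_; allFin; filter; length; lookup)
open import Data.List.Membership.Propositional using () renaming (_∈_ to _∈ˡ_)
open import Data.List.Membership.Propositional.Properties using (∈-allFin)
open import Data.List.Relation.Unary.Any using (here; there)
open import Data.Nat.Base as ℕ using (ℕ; zero; suc; NonZero)
import Data.Nat.Properties as ℕ
open import Data.Product.Base using (∃; Σ-syntax; ∃-syntax; _×_; _,_; proj₁; proj₂)
open import Data.Rational.Unnormalised.Base as ℚ using (ℚᵘ; 0ℚᵘ; 1ℚᵘ; ½)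
import Data.Rational.Unnormalised.Properties as ℚ
open import Data.Rational.Unnormalised.Solver using (module +-*-Solver)
open import Data.Sum.Base using (_⊎_; inj₁; inj₂)
open import Function.Base using (_∘_)
open import Function.Bundles using (_↔_; _⇔_; mk⇔; Equivalence; Inverse)
open import Level using (0ℓ)
open import Relation.Binary.Construct.Closure.ReflexiveTransitive
  using (Star; ε; _◅_; _◅◅_; reverse)
open import Relation.Binary.Core using (Rel)
open import Relation.Binary.Definitions using (Decidable)
open import Relation.Binary.Structures using (IsEquivalence)
open import Relation.Binary.PropositionalEquality
  using (_≡_; refl; cong; subst)
open import Relation.Nullary.Decidable using (yes; no; ¬?; _×-dec_; _⊎-dec_; map′)
open import Relation.Nullary.Negation using (contradiction)
open import Relation.Unary using (Pred)

------------------------------------------------------------------------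
-- Real numbers, as Cauchy sequences of rationals

record ℝ : Set where
  field
    seq    : ℕ → ℚᵘ
    cauchy : ∀ δ → 0ℚᵘ ℚ.< δ →
             ∃[ N ] ∀ m n → N ℕ.≤ m → N ℕ.≤ n → ℚ.∣ seq m ℚ.- seq n ∣ ℚ.≤ δ

open ℝ public

infix  4 _≤ℝ_ _<ℝ_
infixl 6 _+ℝ_ _-ℝ_
infix  8 -ℝ_
infixl 7 _·ℝ_

_≤ℝ_ : Rel ℝ 0ℓ
x ≤ℝ y = ∀ δ → 0ℚᵘ ℚ.< δ → ∃[ N ] ∀ n → N ℕ.≤ n → seq x n ℚ.≤ seq y n ℚ.+ δ

_<ℝ_ : Rel ℝ 0ℓ
x <ℝ y = ∃[ δ ] 0ℚᵘ ℚ.< δ × (∃[ N ] ∀ n → N ℕ.≤ n → seq x n ℚ.+ δ ℚ.≤ seq y n)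

fromℚ : ℚᵘ → ℝ
fromℚ q .seq _ = q
fromℚ q .cauchy δ 0<δ = 0 , λ _ _ _ _ →
  ℚ.≤-respˡ-≃ (ℚ.≃-sym (ℚ.∣-∣-cong (ℚ.+-inverseʳ q))) (ℚ.<⇒≤ 0<δ)

fromℕ : ℕ → ℝ
fromℕ n = fromℚ (+ n ℚ./ 1)

0ℝ : ℝ
0ℝ = fromℕ 0

_+ℝ_ : ℝ → ℝ → ℝ
(x +ℝ y) .seq n = seq x n ℚ.+ seq y n
(x +ℝ y) .cauchy δ 0<δ with cauchy x (½ ℚ.* δ) 0<½δ | cauchy y (½ ℚ.* δ) 0<½δ
  where
  0<½δ : 0ℚᵘ ℚ.< ½ ℚ.* δ
  0<½δ = ℚ.positive⁻¹ _ {{ℚ.pos*pos⇒pos ½ δ {{ℚ.positive 0<δ}}}}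
... | M , p | N , q = M ℕ.⊔ N , λ m n m≥ n≥ → begin
  ℚ.∣ (seq x m ℚ.+ seq y m) ℚ.- (seq x n ℚ.+ seq y n) ∣
    ≃⟨ ℚ.∣-∣-cong (solve 4 (λ a b c d →
         (a :+ b) :- (c :+ d) := (a :- c) :+ (b :- d)) ℚ.≃-refl
         (seq x m) (seq y m) (seq x n) (seq y n)) ⟩
  ℚ.∣ (seq x m ℚ.- seq x n) ℚ.+ (seq y m ℚ.- seq y n) ∣
    ≤⟨ ℚ.∣p+q∣≤∣p∣+∣q∣ (seq x m ℚ.- seq x n) (seq y m ℚ.- seq y n) ⟩
  ℚ.∣ seq x m ℚ.- seq x n ∣ ℚ.+ ℚ.∣ seq y m ℚ.- seq y n ∣
    ≤⟨ ℚ.+-mono-≤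
         (p m n (ℕ.m⊔n≤o⇒m≤o M N m≥) (ℕ.m⊔n≤o⇒m≤o M N n≥))
         (q m n (ℕ.m⊔n≤o⇒n≤o M N m≥) (ℕ.m⊔n≤o⇒n≤o M N n≥)) ⟩
  ½ ℚ.* δ ℚ.+ ½ ℚ.* δ
    ≃⟨ ℚ.*-distribʳ-+ δ ½ ½ ⟨
  (½ ℚ.+ ½) ℚ.* δ
    ≃⟨ ℚ.*-congʳ {δ} {½ ℚ.+ ½} {1ℚᵘ} (ℚ.*≡* refl) ⟩
  1ℚᵘ ℚ.* δ
    ≃⟨ ℚ.*-identityˡ δ ⟩
  δ ∎
  where
  open ℚ.≤-Reasoning
  open +-*-Solver

-ℝ_ : ℝ → ℝ
(-ℝ x) .seq n = ℚ.- seq x n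
(-ℝ x) .cauchy δ 0<δ with cauchy x δ 0<δ
... | N , p = N , λ m n m≥ n≥ → begin
  ℚ.∣ ℚ.- seq x m ℚ.- ℚ.- seq x n ∣
    ≃⟨ ℚ.∣-∣-cong (solve 2 (λ a b → :- a :- :- b := b :- a) ℚ.≃-refl
         (seq x m) (seq x n)) ⟩
  ℚ.∣ seq x n ℚ.- seq x m ∣
    ≤⟨ p n m n≥ m≥ ⟩
  δ ∎
  where
  open ℚ.≤-Reasoning
  open +-*-Solver

_-ℝ_ : ℝ → ℝ → ℝ
x -ℝ y = x +ℝ (-ℝ y)

_·ℝ_ : ℕ → ℝ → ℝ
zero  ·ℝ x = 0ℝ
suc n ·ℝ x = x +ℝ n ·ℝ x

------------------------------------------------------------------------
-- Loopless multigraphs on Fin n, given by their edge multiplicities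

record Graph (n : ℕ) : Set where
  field
    mult     : Fin n → Fin n → ℕ
    mult-sym : ∀ u v → mult u v ≡ mult v u
    loopless : ∀ v → mult v v ≡ 0

open Graph public

degree : ∀ {n} → Graph n → Fin n → ℕ
degree G v = sum (mult G v)
  where open Algebra.Properties.CommutativeMonoid.Sum ℕ.+-0-commutativeMonoid

Adj : ∀ {n} → Graph n → Rel (Fin n) 0ℓ
Adj G u v = 0 ℕ.< mult G u v

Joined : ∀ {n} → Graph n → Rel (Fin n) 0ℓ
Joined G = Star (Adj G)

Connected : ∀ {n} → Graph n → Set
Connected G = ∀ u v → Joined G u v

_≅_ : ∀ {m n} → Graph m → Graph n → Set
_≅_ {m} {n} G H =
  Σ[ φ ∈ Fin m ↔ Fin n ]
    ∀ u v → mult G u v ≡ mult H (Inverse.to φ u) (Inverse.to φ v)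

-- Vertex i of G ∖ S is the i-th vertex of G outside S.
remaining : ∀ {n} → Subset n → List (Fin n)
remaining S = filter (λ v → ¬? (v ∈? S)) (allFin _)

_∖_ : ∀ {n} → Graph n → (S : Subset n) → Graph (length (remaining S))
(G ∖ S) .mult i j     = mult G (lookup (remaining S) i) (lookup (remaining S) j)
(G ∖ S) .mult-sym i j = mult-sym G _ _
(G ∖ S) .loopless i   = loopless G _

iso : ∀ {n} → Graph n → ℕ
iso G = length (filter (λ v → degree G v ℕ.≟ 0) (allFin _))

------------------------------------------------------------------------
-- Number of connected components

-- k is the number of classes of _~_: the quotient of A by _~_ is Fin k.
Classes : {A : Set} → Rel A 0ℓ → ℕ → Set
Classes {A} _~_ k =
  Σ[ class ∈ (A → Fin k) ]
    (∀ c → ∃[ a ] class a ≡ c) × (∀ a b → a ~ b ⇔ class a ≡ class b)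

classes : ∀ {n} {_~_ : Rel (Fin n) 0ℓ} →
          IsEquivalence _~_ → Decidable _~_ → ∃ (Classes _~_)
classes {zero}  _  _  = 0 , (λ ()) , (λ ()) , (λ ())
classes {suc n} {_~_} eq _~?_ with classes {n} {λ i j → suc i ~ suc j}
    (record { refl = E.refl ; sym = E.sym ; trans = E.trans }) (λ i j → suc i ~? suc j)
    | any? (λ i → zero ~? suc i)
  where module E = IsEquivalence eq
... | k , class , onto , exact | yes (i , 0~i) = k , class′ , onto′ , exact′
  where
  module E = IsEquivalence eq
  class′ : Fin (suc n) → Fin k
  class′ zero    = class i
  class′ (suc j) = class j
  onto′ : ∀ c → ∃[ a ] class′ a ≡ c
  onto′ c = suc (proj₁ (onto c)) , proj₂ (onto c)
  exact′ : ∀ a b → a ~ b ⇔ class′ a ≡ class′ b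
  exact′ zero    zero    = mk⇔ (λ _ → refl) (λ _ → E.refl)
  exact′ zero    (suc b) = mk⇔
    (λ p → Equivalence.to (exact i b) (E.trans (E.sym 0~i) p))
    (λ p → E.trans 0~i (Equivalence.from (exact i b) p))
  exact′ (suc a) zero    = mk⇔
    (λ p → Equivalence.to (exact a i) (E.trans p 0~i))
    (λ p → E.trans (Equivalence.from (exact a i) p) (E.sym 0~i))
  exact′ (suc a) (suc b) = exact a b
... | k , class , onto , exact | no 0≁ = suc k , class′ , onto′ , exact′
  where
  module E = IsEquivalence eq
  class′ : Fin (suc n) → Fin (suc k)
  class′ zero    = zero
  class′ (suc j) = suc (class j)
  onto′ : ∀ c → ∃[ a ] class′ a ≡ c
  onto′ zero    = zero , refl
  onto′ (suc c) = suc (proj₁ (onto c)) , cong suc (proj₂ (onto c))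
  exact′ : ∀ a b → a ~ b ⇔ class′ a ≡ class′ b
  exact′ zero    zero    = mk⇔ (λ _ → refl) (λ _ → E.refl)
  exact′ zero    (suc b) = mk⇔ (λ p → contradiction (b , p) 0≁) (λ ())
  exact′ (suc a) zero    = mk⇔ (λ p → contradiction (a , E.sym p) 0≁) (λ ())
  exact′ (suc a) (suc b) = mk⇔
    (λ p → cong suc (Equivalence.to (exact a b) p))
    (λ p → Equivalence.from (exact a b) (Fin.suc-injective p))

-- Warshall's algorithm: Via L u v holds when v is reachable from u by a walk
-- whose intermediate vertices lie in L.
module Reachability {n} {R : Rel (Fin n) 0ℓ} (R? : Decidable R) where

  Via : List (Fin n) → Rel (Fin n) 0ℓ
  Via []      u v = u ≡ v ⊎ R u v
  Via (w ∷ L) u v = Via L u v ⊎ (Via L u w × Via L w v)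

  via? : ∀ L → Decidable (Via L)
  via? []      u v = u Fin.≟ v ⊎-dec R? u v
  via? (w ∷ L) u v = via? L u v ⊎-dec (via? L u w ×-dec via? L w v)

  via⇒star : ∀ L {u v} → Via L u v → Star R u v
  via⇒star []      (inj₁ refl)    = ε
  via⇒star []      (inj₂ r)       = r ◅ ε
  via⇒star (w ∷ L) (inj₁ p)       = via⇒star L p
  via⇒star (w ∷ L) (inj₂ (p , q)) = via⇒star L p ◅◅ via⇒star L q

  via-base : ∀ L {u v} → u ≡ v ⊎ R u v → Via L u v
  via-base []      p = p
  via-base (w ∷ L) p = inj₁ (via-base L p)

  via-trans : ∀ L {u v w} → w ∈ˡ L → Via L u w → Via L w v → Via L u v
  via-trans (x ∷ L) (here refl) p q = inj₂ (left p , right q)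
    where
    left : ∀ {u} → Via (x ∷ L) u x → Via L u x
    left (inj₁ a)       = a
    left (inj₂ (a , _)) = a
    right : ∀ {v} → Via (x ∷ L) x v → Via L x v
    right (inj₁ a)       = a
    right (inj₂ (_ , a)) = a
  via-trans (x ∷ L) (there i) (inj₁ a)       (inj₁ b)       = inj₁ (via-trans L i a b)
  via-trans (x ∷ L) (there i) (inj₁ a)       (inj₂ (b , c)) = inj₂ (via-trans L i a b , c)
  via-trans (x ∷ L) (there i) (inj₂ (a , b)) (inj₁ c)       = inj₂ (a , via-trans L i b c)
  via-trans (x ∷ L) (there i) (inj₂ (a , _)) (inj₂ (_ , d)) = inj₂ (a , d)

  star⇒via : ∀ {u v} → Star R u v → Via (allFin n) u v
  star⇒via ε       = via-base (allFin n) (inj₁ refl)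
  star⇒via (r ◅ p) =
    via-trans (allFin n) (∈-allFin _) (via-base (allFin n) (inj₂ r)) (star⇒via p)

  star? : Decidable (Star R)
  star? u v = map′ (via⇒star (allFin n)) star⇒via (via? (allFin n) u v)

joined? : ∀ {n} (G : Graph n) → Decidable (Joined G)
joined? G = Reachability.star? (λ u v → 0 ℕ.<? mult G u v)

joined-isEquivalence : ∀ {n} (G : Graph n) → IsEquivalence (Joined G)
joined-isEquivalence G = record
  { refl  = ε
  ; sym   = reverse (λ {u} {v} → subst (0 ℕ.<_) (mult-sym G u v))
  ; trans = _◅◅_
  }

components : ∀ {n} (G : Graph n) → ∃ (Classes (Joined G))
components G = classes (joined-isEquivalence G) (joined? G)

ω : ∀ {n} → Graph n → ℕ
ω G = proj₁ (components G)

------------------------------------------------------------------------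
-- Toughness and factors

-- For t > 0 this is  ω (G ∖ S) ≤ max {1 , ∣ S ∣ / t},  with the division by t
-- cleared.  For t ≤ 0 it holds for every G.
Tough : ℝ → ∀ {n} → Graph n → Set
Tough t {n} G = ∀ (S : Subset n) → ω (G ∖ S) ℕ.≤ 1 ⊎ ω (G ∖ S) ·ℝ t ≤ℝ fromℕ ∣ S ∣

_SpanningSubgraphOf_ : ∀ {n} → Graph n → Graph n → Set
F SpanningSubgraphOf G = ∀ u v → mult F u v ℕ.≤ mult G u v

_IsFactor_of_ : ∀ {n} → Graph n → Pred ℤ 0ℓ → Graph n → Set
F IsFactor A of G = F SpanningSubgraphOf G × (∀ v → A (+ degree F v))

HasConnectedFactor : Pred ℤ 0ℓ → ∀ {n} → Graph n → Set
HasConnectedFactor A G = ∃[ F ] F IsFactor A of G × Connected F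

-- {2, 4, …, 2r}
evens : ℕ → Pred ℤ 0ℓ
evens r z = ∃[ i ] 1 ℕ.≤ i × i ℕ.≤ r × z ≡ + (2 ℕ.* i)

-- Graphs are counted up to isomorphism.
InfinitelyManyGraphs : (∀ {n} → Graph n → Set) → Set
InfinitelyManyGraphs P =
  Σ[ G ∈ (ℕ → ∃ Graph) ]
    (∀ i j → proj₂ (G i) ≅ proj₂ (G j) → i ≡ j) × (∀ i → P (proj₂ (G i)))

{-# OPTIONS --safe #-}

-- Take m = 2rℓ + 1 copies of the Petersen graph, glued at one vertex (the root), and blow
-- every vertex up to a large clique, the edges being attached at distinct vertices of the
-- cliques.  Join a further clique of ℓ vertices (the hub) to everything.
--
-- A factor with degrees at most 2r has at most 2rℓ edges at the hub, so some copy receives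
-- none of them.  If all degrees are even, the factor crosses the boundary of each blown-up
-- vertex of that copy an even number of times; connectedness would make it a Hamiltonian
-- cycle of the Petersen graph.
--
-- The Petersen graph has five spanning trees that use every edge three times.  When the hub
-- is deleted, every component without root vertices meets, for each tree, a vertex clique
-- whose edge to its parent was destroyed, and a deleted vertex destroys at most one edge.  Hence
-- c + 1 components require 3∣S∣ ≥ 3ℓ + 5c, where c ≤ 9m.

module Submission where

open import Defs
import Algebra.Properties.CommutativeMonoid.Sum
open import Data.Bool.Base using (Bool; true; false; if_then_else_; not; _∧_)
open import Data.Fin using (#_)
open import Data.Fin.Base
  using (Fin; zero; suc; punchIn; punchOut; combine; quotient; remainder; _↑ˡ_; fromℕ<;
         splitAt; join)
open import Data.Fin.Permutation using (↔⇒≡)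
import Data.Fin.Properties as Fin
open import Data.Fin.Subset using (Subset; _∈_; _∉_; ∣_∣; Nonempty; inside; outside)
open import Data.Fin.Subset.Properties using (_∈?_; anySubset?; nonempty?)
open import Data.Integer.Base using (ℤ; +_)
import Data.Integer.Base as ℤ
import Data.Integer.Properties as ℤ
import Data.Integer.Tactic.RingSolver as ℤ-Solver
open import Data.List.Base using (List; allFin; filter; length)
import Data.List.Base as List
open import Data.List.Membership.Propositional.Properties
  using (∈-allFin; ∈-filter⁺; ∈-filter⁻; ∈-lookup)
import Data.List.Relation.Unary.All as All
import Data.List.Relation.Unary.Any as Any
open import Data.List.Relation.Unary.Any.Properties using (lookup-index)
open import Data.List.Relation.Unary.Unique.Propositional using (Unique; _∷_)
open import Data.List.Relation.Unary.Unique.Propositional.Properties using (allFin⁺; filter⁺)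
open import Data.Maybe.Base using (Maybe; just; nothing)
import Data.Maybe.Properties as Maybe
open import Data.Nat.Base using (ℕ; NonZero; zero; suc; pred; z≤n; s≤s; z<s)
import Data.Nat.Base as ℕ
open import Data.Nat.Divisibility using (_∣_; _∣?_; _∣0; ∣m∣n⇒∣m+n; ∣m+n∣m⇒∣n; m∣m*n)
open import Data.Nat.Properties using (m*n≢0)
import Data.Nat.Properties as ℕ
open import Data.Nat.Tactic.RingSolver using (solve-∀)
open import Data.Product.Base using (∃; ∃₂; ∃-syntax; _×_; _,_; proj₁; proj₂)
import Data.Product.Properties as Product
open import Data.Rational.Unnormalised.Base
  using (ℚᵘ; mkℚᵘ; 0ℚᵘ; _/_; _+_; _*_; _-_; _≤_; *≤*; *<*; *≡*)
import Data.Rational.Unnormalised.Properties as ℚ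
open import Data.Sum.Base using (_⊎_; inj₁; inj₂; [_,_]′; map₂)
open import Data.Unit.Base using (⊤; tt)
open import Data.Vec.Base using (Vec; []; _∷_; here; there)
import Data.Vec.Base as Vec
open import Data.Vec.Functional using (removeAt)
open import Data.Vec.Properties using (lookup∘tabulate; lookup⇒[]=)
open import Function.Base using (_∘_; id)
open import Function.Bundles using (Equivalence; mk⇔)
open import Level using (0ℓ)
open import Relation.Binary.Construct.Closure.ReflexiveTransitive using (_◅_)
import Relation.Binary.Construct.Closure.ReflexiveTransitive as Star
open import Relation.Binary.Core using (Rel)
open import Relation.Binary.Definitions using (Decidable; Symmetric; tri<; tri≈; tri>)
open import Relation.Binary.PropositionalEquality
open import Relation.Nullary.Decidable
open import Relation.Nullary.Negation using (¬_; contradiction)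

open Algebra.Properties.CommutativeMonoid.Sum ℕ.+-0-commutativeMonoid
  using (sum; sum-remove; sum-cong-≗; sum-replicate-zero; ∑-distrib-+; ∑-comm)

-- The Petersen graph

-- Vertices 0–4 form the outer cycle and 5–9 the inner pentagram.  Port s of b is joined to
-- port swap s of neighbour b s.
abstract
  neighbour : Fin 10 → Fin 3 → Fin 10
  neighbour b s = Vec.lookup (Vec.lookup table b) s
    where
    table : Vec (Vec (Fin 10) 3) 10
    table =
      (# 1 ∷ # 4 ∷ # 5 ∷ []) ∷ (# 2 ∷ # 0 ∷ # 6 ∷ []) ∷ (# 3 ∷ # 1 ∷ # 7 ∷ []) ∷
      (# 4 ∷ # 2 ∷ # 8 ∷ []) ∷ (# 0 ∷ # 3 ∷ # 9 ∷ []) ∷ (# 7 ∷ # 8 ∷ # 0 ∷ []) ∷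
      (# 8 ∷ # 9 ∷ # 1 ∷ []) ∷ (# 9 ∷ # 5 ∷ # 2 ∷ []) ∷ (# 5 ∷ # 6 ∷ # 3 ∷ []) ∷
      (# 6 ∷ # 7 ∷ # 4 ∷ []) ∷ []

  edge : Fin 10 → Fin 3 → Fin 15
  edge b s = Vec.lookup (Vec.lookup table b) s
    where
    table : Vec (Vec (Fin 15) 3) 10
    table =
      (# 0 ∷ # 4 ∷ # 5 ∷ []) ∷ (# 1 ∷ # 0 ∷ # 6 ∷ []) ∷ (# 2 ∷ # 1 ∷ # 7 ∷ []) ∷
      (# 3 ∷ # 2 ∷ # 8 ∷ []) ∷ (# 4 ∷ # 3 ∷ # 9 ∷ []) ∷ (# 10 ∷ # 13 ∷ # 5 ∷ []) ∷
      (# 11 ∷ # 14 ∷ # 6 ∷ []) ∷ (# 12 ∷ # 10 ∷ # 7 ∷ []) ∷ (# 13 ∷ # 11 ∷ # 8 ∷ []) ∷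
      (# 14 ∷ # 12 ∷ # 9 ∷ []) ∷ []

  -- Port 0 leads forward along its 5-cycle, port 1 backward and port 2 along the spoke. An edge of
  -- a 5-cycle thus joins a port 0 to a port 1, and a spoke joins two ports 2.
  swap : Fin 3 → Fin 3
  swap zero             = suc zero
  swap (suc zero)       = zero
  swap (suc (suc zero)) = suc (suc zero)

  swap-involutive : ∀ s → swap (swap s) ≡ s
  swap-involutive = from-yes (Fin.all? λ s → swap (swap s) Fin.≟ s)

  neighbour-involutive : ∀ b s → neighbour (neighbour b s) (swap s) ≡ b
  neighbour-involutive = from-yes
    (Fin.all? λ b → Fin.all? λ s → neighbour (neighbour b s) (swap s) Fin.≟ b)

  edge-neighbour : ∀ b s → edge (neighbour b s) (swap s) ≡ edge b s
  edge-neighbour = from-yes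
    (Fin.all? λ b → Fin.all? λ s → edge (neighbour b s) (swap s) Fin.≟ edge b s)

  neighbour≢ : ∀ b s → neighbour b s ≢ b
  neighbour≢ = from-yes (Fin.all? λ b → Fin.all? λ s → ¬? (neighbour b s Fin.≟ b))

  edge-ends : ∀ b s c t → edge b s ≡ edge c t →
              (c ≡ b × t ≡ s) ⊎ (c ≡ neighbour b s × t ≡ swap s)
  edge-ends = from-yes (Fin.all? λ b → Fin.all? λ s → Fin.all? λ c → Fin.all? λ t →
    (edge b s Fin.≟ edge c t) →-dec
    ((c Fin.≟ b ×-dec t Fin.≟ s) ⊎-dec (c Fin.≟ neighbour b s ×-dec t Fin.≟ swap s)))

  edge-onto : ∀ e → ∃ λ b → ∃ λ s → edge b s ≡ e
  edge-onto = from-yes (Fin.all? λ e → Fin.any? λ b → Fin.any? λ s → edge b s Fin.≟ e)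

-- Five spanning trees rooted at 0, that together use every edge exactly three times:
-- up t b is the port of suc b towards its parent in tree t, and slot t b tells apart
-- the three trees that share that edge.
abstract
  up : Fin 5 → Fin 9 → Fin 3
  up t b = Vec.lookup (Vec.lookup table t) b
    where
    table : Vec (Vec (Fin 3) 9) 5
    table =
      (# 1 ∷ # 1 ∷ # 1 ∷ # 2 ∷ # 2 ∷ # 2 ∷ # 0 ∷ # 1 ∷ # 0 ∷ []) ∷
      (# 0 ∷ # 2 ∷ # 1 ∷ # 1 ∷ # 2 ∷ # 2 ∷ # 1 ∷ # 0 ∷ # 1 ∷ []) ∷
      (# 2 ∷ # 0 ∷ # 0 ∷ # 0 ∷ # 1 ∷ # 0 ∷ # 2 ∷ # 2 ∷ # 0 ∷ []) ∷
      (# 1 ∷ # 2 ∷ # 0 ∷ # 0 ∷ # 0 ∷ # 1 ∷ # 0 ∷ # 2 ∷ # 2 ∷ []) ∷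
      (# 1 ∷ # 1 ∷ # 2 ∷ # 0 ∷ # 2 ∷ # 0 ∷ # 1 ∷ # 0 ∷ # 2 ∷ []) ∷ []

  slot : Fin 5 → Fin 9 → Fin 3
  slot t b = Vec.lookup (Vec.lookup table t) b
    where
    table : Vec (Vec (Fin 3) 9) 5
    table =
      (# 0 ∷ # 1 ∷ # 2 ∷ # 2 ∷ # 0 ∷ # 1 ∷ # 1 ∷ # 0 ∷ # 2 ∷ []) ∷
      (# 0 ∷ # 1 ∷ # 1 ∷ # 2 ∷ # 2 ∷ # 0 ∷ # 2 ∷ # 1 ∷ # 0 ∷ []) ∷
      (# 2 ∷ # 0 ∷ # 1 ∷ # 2 ∷ # 0 ∷ # 2 ∷ # 0 ∷ # 1 ∷ # 1 ∷ []) ∷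
      (# 2 ∷ # 2 ∷ # 0 ∷ # 1 ∷ # 1 ∷ # 0 ∷ # 2 ∷ # 0 ∷ # 1 ∷ []) ∷
      (# 1 ∷ # 2 ∷ # 2 ∷ # 0 ∷ # 1 ∷ # 1 ∷ # 0 ∷ # 2 ∷ # 0 ∷ []) ∷ []

upEdge : Fin 5 → Fin 9 → Fin 15
upEdge t b = edge (suc b) (up t b)

abstract
  -- Five trees with nine edges each fill the 15 times 3 pairs of an edge and a slot. Injectivity is
  -- what limits the charges on one edge to three.
  upEdge-slot-injective : ∀ t b l c → upEdge t b ≡ upEdge l c → slot t b ≡ slot l c →
                          t ≡ l × b ≡ c
  upEdge-slot-injective = from-yes (Fin.all? λ t → Fin.all? λ b → Fin.all? λ l → Fin.all? λ c →
    (upEdge t b Fin.≟ upEdge l c) →-dec (slot t b Fin.≟ slot l c) →-dec (t Fin.≟ l ×-dec b Fin.≟ c))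

-- The root is its own parent, so any number of steps that is at least the depth of a vertex leads
-- to the root.
parent : Fin 5 → Fin 10 → Fin 10
parent t zero    = zero
parent t (suc b) = neighbour (suc b) (up t b)

ancestor : Fin 5 → ℕ → Fin 10 → Fin 10
ancestor t zero    b = b
ancestor t (suc d) b = ancestor t d (parent t b)

abstract
  ancestor₅≡root : ∀ t b → ancestor t 5 b ≡ zero
  ancestor₅≡root = from-yes (Fin.all? λ t → Fin.all? λ b → ancestor t 5 b Fin.≟ zero)

-- Even edge sets of the Petersen graph

bit : Bool → ℕ
bit b = if b then 1 else 0

EvenAt : Subset 15 → Fin 10 → Set
EvenAt y b = 2 ∣ sum (λ s → bit (Vec.lookup y (edge b s)))

-- `W` is a nonempty union of components of the edge set `y` that avoids the root; `outside ∷ W` is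
-- `W` as a set of vertices of the whole Petersen graph.
Isolates : Subset 9 → Subset 15 → Set
Isolates W y = Nonempty W ×
  (∀ b → b ∈ W → ∀ s → edge (suc b) s ∈ y → neighbour (suc b) s ∈ outside ∷ W)

evenAt? : ∀ y b → Dec (EvenAt y b)
evenAt? y b = 2 ∣? _

isolates? : ∀ W y → Dec (Isolates W y)
isolates? W y = nonempty? W ×-dec Fin.all? λ b → (b ∈? W) →-dec
  Fin.all? λ s → (edge (suc b) s ∈? y) →-dec (neighbour (suc b) s ∈? outside ∷ W)

abstract
  -- By the handshake lemma the root has even degree too, so in this cubic graph all degrees are 0
  -- or 2. If no `W` existed, `y` would be a Hamiltonian cycle, and the Petersen graph has none. The
  -- verification is a search through all 2^15 edge sets.
  even⇒isolates : ∀ y → (∀ b → EvenAt y (suc b)) → ∃ λ W → Isolates W y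
  -- The search is for a counterexample `y`, which makes it one closed decision; `W` is recovered
  -- from its double negation by decidability.
  even⇒isolates y ev = decidable-stable (anySubset? λ W → isolates? W y) λ ¬c →
    from-no (anySubset? {n = 15} λ y →
      Fin.all? (λ b → evenAt? y (suc b)) ×-dec ¬? (anySubset? λ W → isolates? W y)) (y , ev , ¬c)

-- Counting and parity

remQuot-injective : ∀ {m n} {x y : Fin (m ℕ.* n)} → quotient {m} n x ≡ quotient {m} n y →
                    remainder {m} n x ≡ remainder {m} n y → x ≡ y
remQuot-injective {m} {n} {x} {y} eqᑫ eqʳ = begin
  x                                               ≡⟨ Fin.combine-remQuot {m} n x ⟨
  combine (quotient {m} n x) (remainder {m} n x)  ≡⟨ cong₂ combine eqᑫ eqʳ ⟩
  combine (quotient {m} n y) (remainder {m} n y)  ≡⟨ Fin.combine-remQuot {m} n y ⟩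
  y                                               ∎
  where open ≡-Reasoning

rank : ∀ {n} {S : Subset n} {x} → x ∈ S → Fin ∣ S ∣
rank {S = inside  ∷ _} here      = zero
rank {S = inside  ∷ _} (there p) = suc (rank p)
rank {S = outside ∷ _} (there p) = rank p

rank-injective : ∀ {n} {S : Subset n} {x y} (p : x ∈ S) (q : y ∈ S) →
                 rank p ≡ rank q → x ≡ y
rank-injective {S = inside  ∷ _} here      here      _  = refl
rank-injective {S = inside  ∷ _} (there p) (there q) eq =
  cong suc (rank-injective p q (Fin.suc-injective eq))
rank-injective {S = outside ∷ _} (there p) (there q) eq = cong suc (rank-injective p q eq)

-- The charging principle: every item charges an element of `S`, and `g` tells apart the at most `d`
-- items that charge the same element.
injective⇒≤∣S∣*d : ∀ {N n d} {S : Subset n} (f : Fin N → Fin n) (g : Fin N → Fin d) →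
  (∀ a → f a ∈ S) → (∀ {a b} → f a ≡ f b → g a ≡ g b → a ≡ b) → N ℕ.≤ ∣ S ∣ ℕ.* d
injective⇒≤∣S∣*d f g f∈S inj =
  Fin.injective⇒≤ {f = λ a → combine (rank (f∈S a)) (g a)} λ {a} {b} eq →
    let eqᶠ , eqᵍ = Fin.combine-injective _ _ _ _ eq
    in inj (rank-injective (f∈S a) (f∈S b) eqᶠ) eqᵍ

sum-mono-≤ : ∀ {n} {f g : Fin n → ℕ} → (∀ i → f i ℕ.≤ g i) → sum f ℕ.≤ sum g
sum-mono-≤ {zero}  _ = z≤n
sum-mono-≤ {suc n} p = ℕ.+-mono-≤ (p zero) (sum-mono-≤ (p ∘ suc))

sum-zero : ∀ {n} {f : Fin n → ℕ} → (∀ i → f i ≡ 0) → sum f ≡ 0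
sum-zero {n} p = trans (sum-cong-≗ p) (sum-replicate-zero n)

term≤sum : ∀ {n} (f : Fin n → ℕ) i → f i ℕ.≤ sum f
term≤sum {suc n} f i = ℕ.≤-trans (ℕ.m≤m+n _ _) (ℕ.≤-reflexive (sym (sum-remove {i = i} f)))

module _ {d n} (g : Fin (suc d) → Fin (suc n)) (inj : ∀ {a b} → g a ≡ g b → a ≡ b) where

  private
    distinct : ∀ a → g zero ≢ g (suc a)
    distinct a eq with () ← inj eq

  -- The injection left after removing `zero` from the domain and `g zero` from the codomain; it
  -- drives the inductions on sums below.
  restrict : Fin d → Fin n
  restrict a = punchOut (distinct a)

  restrict-injective : ∀ {a b} → restrict a ≡ restrict b → a ≡ b
  restrict-injective {a} {b} eq =
    Fin.suc-injective (inj (Fin.punchOut-injective (distinct a) (distinct b) eq))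

  punchIn-restrict : ∀ a → punchIn (g zero) (restrict a) ≡ g (suc a)
  punchIn-restrict a = Fin.punchIn-punchOut (distinct a)

sum-∘-≤ : ∀ {d n} (f : Fin n → ℕ) (g : Fin d → Fin n) →
          (∀ {a b} → g a ≡ g b → a ≡ b) → sum (f ∘ g) ℕ.≤ sum f
sum-∘-≤ {zero}  f g inj = z≤n
sum-∘-≤ {suc d} {zero}  f g inj with () ← g zero
sum-∘-≤ {suc d} {suc n} f g inj = begin
  f (g zero) ℕ.+ sum (f ∘ g ∘ suc)
    ≡⟨ cong (f (g zero) ℕ.+_) (sum-cong-≗ (cong f ∘ punchIn-restrict g inj)) ⟨
  f (g zero) ℕ.+ sum (removeAt f (g zero) ∘ restrict g inj)
    ≤⟨ ℕ.+-monoʳ-≤ (f (g zero)) (sum-∘-≤ _ (restrict g inj) (restrict-injective g inj)) ⟩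
  f (g zero) ℕ.+ sum (removeAt f (g zero))
    ≡⟨ sum-remove f ⟨
  sum f ∎
  where open ℕ.≤-Reasoning

sum-∘-≡ : ∀ {d n} (f : Fin n → ℕ) (g : Fin d → Fin n) → (∀ {a b} → g a ≡ g b → a ≡ b) →
          (∀ v → (∀ a → g a ≢ v) → f v ≡ 0) → sum f ≡ sum (f ∘ g)
sum-∘-≡ {zero}  f g inj off = sum-zero λ v → off v λ ()
sum-∘-≡ {suc d} {zero}  f g inj off with () ← g zero
sum-∘-≡ {suc d} {suc n} f g inj off = begin
  sum f
    ≡⟨ sum-remove f ⟩
  f (g zero) ℕ.+ sum (removeAt f (g zero))
    ≡⟨ cong (f (g zero) ℕ.+_) (sum-∘-≡ _ (restrict g inj) (restrict-injective g inj) off′) ⟩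
  f (g zero) ℕ.+ sum (removeAt f (g zero) ∘ restrict g inj)
    ≡⟨ cong (f (g zero) ℕ.+_) (sum-cong-≗ (cong f ∘ punchIn-restrict g inj)) ⟩
  f (g zero) ℕ.+ sum (f ∘ g ∘ suc) ∎
  where
  open ≡-Reasoning
  off′ : ∀ v → (∀ a → restrict g inj a ≢ v) → f (punchIn (g zero) v) ≡ 0
  off′ v ne = off _ λ
    { zero    eq → Fin.punchInᵢ≢i (g zero) v (sym eq)
    ; (suc a) eq → ne a (Fin.punchIn-injective (g zero) _ _ (trans (punchIn-restrict g inj a) eq)) }

2∣sum : ∀ {n} {f : Fin n → ℕ} → (∀ i → 2 ∣ f i) → 2 ∣ sum f
2∣sum {zero}  _ = 2 ∣0
2∣sum {suc n} p = ∣m∣n⇒∣m+n (p zero) (2∣sum (p ∘ suc))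

-- The handshake lemma: the first row and the first column have equal sums, and removing both leaves
-- a smaller symmetric matrix with zero diagonal.
symmetric⇒2∣sum : ∀ {n} (M : Fin n → Fin n → ℕ) →
                  (∀ u v → M u v ≡ M v u) → (∀ v → M v v ≡ 0) →
                  2 ∣ sum (λ u → sum (M u))
symmetric⇒2∣sum {zero}  M M-sym diag = 2 ∣0
symmetric⇒2∣sum {suc n} M M-sym diag = subst (2 ∣_) (sym eq)
  (∣m∣n⇒∣m+n (m∣m*n row) (symmetric⇒2∣sum
    (λ u v → M (suc u) (suc v)) (λ u v → M-sym _ _) (diag ∘ suc)))
  where
  open ≡-Reasoning
  row rest : ℕ
  row  = sum (λ v → M zero (suc v))
  rest = sum (λ u → sum (λ v → M (suc u) (suc v)))
  eq : sum (λ u → sum (M u)) ≡ 2 ℕ.* row ℕ.+ rest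
  eq = begin
    (M zero zero ℕ.+ row) ℕ.+ sum (λ u → M (suc u) zero ℕ.+ sum (λ v → M (suc u) (suc v)))
      ≡⟨ cong₂ (λ a b → (a ℕ.+ row) ℕ.+ b) (diag zero) (∑-distrib-+ (λ u → M (suc u) zero) _) ⟩
    row ℕ.+ (sum (λ u → M (suc u) zero) ℕ.+ rest)
      ≡⟨ cong (λ a → row ℕ.+ (a ℕ.+ rest)) (sum-cong-≗ λ u → M-sym (suc u) zero) ⟩
    row ℕ.+ (row ℕ.+ rest)
      ≡⟨ double row rest ⟩
    2 ℕ.* row ℕ.+ rest ∎
    where
    double : ∀ a b → a ℕ.+ (a ℕ.+ b) ≡ 2 ℕ.* a ℕ.+ b
    double = solve-∀

crossing : ∀ {n} → (Fin n → Bool) → (Fin n → Fin n → ℕ) → Fin n → Fin n → ℕ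
crossing χ M u v = if χ u ∧ not (χ v) then M u v else 0

-- The degrees on the side `χ` add up to the cut plus the degree sum of the subgraph induced on that
-- side. The total is even by hypothesis and the induced part by the handshake lemma.
2∣cut : ∀ {n} (χ : Fin n → Bool) (M : Fin n → Fin n → ℕ) →
        (∀ u v → M u v ≡ M v u) → (∀ v → M v v ≡ 0) → (∀ v → 2 ∣ sum (M v)) →
        2 ∣ sum (λ u → sum (crossing χ M u))
2∣cut {n} χ M M-sym diag even = ∣m+n∣m⇒∣n (subst (2 ∣_) split (2∣sum row-even))
  (symmetric⇒2∣sum inner inner-sym inner-diag)
  where
  inner : Fin n → Fin n → ℕ
  inner u v = if χ u ∧ χ v then M u v else 0
  inner-sym : ∀ u v → inner u v ≡ inner v u
  inner-sym u v with χ u | χ v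
  ... | true  | true  = M-sym u v
  ... | true  | false = refl
  ... | false | true  = refl
  ... | false | false = refl
  inner-diag : ∀ v → inner v v ≡ 0
  inner-diag v with χ v
  ... | true  = diag v
  ... | false = refl
  row : Fin n → ℕ
  row u = if χ u then sum (M u) else 0
  row-even : ∀ u → 2 ∣ row u
  row-even u with χ u
  ... | true  = even u
  ... | false = 2 ∣0
  row-split : ∀ u → row u ≡ sum (inner u) ℕ.+ sum (crossing χ M u)
  row-split u with χ u
  ... | false = sym (cong₂ ℕ._+_ (sum-replicate-zero n) (sum-replicate-zero n))
  ... | true  = trans (sum-cong-≗ term) (∑-distrib-+ (λ v → if χ v then M u v else 0) _)
    where
    term : ∀ v → M u v ≡ (if χ v then M u v else 0) ℕ.+ (if not (χ v) then M u v else 0)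
    term v with χ v
    ... | true  = sym (ℕ.+-identityʳ _)
    ... | false = refl
  split : sum row ≡ sum (λ u → sum (inner u)) ℕ.+ sum (λ u → sum (crossing χ M u))
  split = trans (sum-cong-≗ row-split) (∑-distrib-+ (λ u → sum (inner u)) _)

-- Deleting vertices

lookup-injective : ∀ {A : Set} {xs : List A} → Unique xs →
                   ∀ i j → List.lookup xs i ≡ List.lookup xs j → i ≡ j
lookup-injective (_ ∷ _)  zero    zero    _  = refl
lookup-injective (p ∷ _)  zero    (suc j) eq = contradiction eq (All.lookup p (∈-lookup j))
lookup-injective (p ∷ _)  (suc i) zero    eq = contradiction (sym eq) (All.lookup p (∈-lookup i))
lookup-injective (_ ∷ ps) (suc i) (suc j) eq = cong suc (lookup-injective ps i j eq)

module Deletion {n} (G : Graph n) (S : Subset n) where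

  vertex : Fin (length (remaining S)) → Fin n
  vertex = List.lookup (remaining S)

  vertex∉S : ∀ a → vertex a ∉ S
  vertex∉S a = proj₂ (∈-filter⁻ (λ v → ¬? (v ∈? S)) {xs = allFin n} (∈-lookup a))

  vertex-injective : ∀ {a b} → vertex a ≡ vertex b → a ≡ b
  vertex-injective = lookup-injective (filter⁺ (λ v → ¬? (v ∈? S)) (allFin⁺ n)) _ _

  index : ∀ {v} → v ∉ S → ∃[ a ] vertex a ≡ v
  index v∉S = Any.index v∈ , sym (lookup-index v∈)
    where v∈ = ∈-filter⁺ (λ v → ¬? (v ∈? S)) (∈-allFin _) v∉S

  isolated : Fin (iso (G ∖ S)) → Fin n
  isolated = vertex ∘ List.lookup (filter (λ v → degree (G ∖ S) v ℕ.≟ 0) (allFin _))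

  isolated-injective : ∀ {a b} → isolated a ≡ isolated b → a ≡ b
  isolated-injective eq =
    lookup-injective (filter⁺ (λ v → degree (G ∖ S) v ℕ.≟ 0) (allFin⁺ _)) _ _ (vertex-injective eq)

  neighbour-of-isolated∈S : ∀ a {v} → Adj G (isolated a) v → v ∈ S
  neighbour-of-isolated∈S a {v} adj = decidable-stable (v ∈? S) λ v∉S →
    let i = List.lookup (filter (λ v → degree (G ∖ S) v ℕ.≟ 0) (allFin _)) a
        b , eq = index v∉S
        deg≡0 = proj₂ (∈-filter⁻ (λ v → degree (G ∖ S) v ℕ.≟ 0) {xs = allFin _} (∈-lookup a))
    in ℕ.<⇒≱ adj (subst₂ ℕ._≤_ (cong (mult G (isolated a)) eq) deg≡0
                    (term≤sum (mult (G ∖ S) i) b))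

  -- An arbitrary partition into classes stands in for `components`, so nothing here depends on how
  -- the components are computed.
  module Components {κ} (classes : Classes (Joined (G ∖ S)) κ) where

    component : Fin (length (remaining S)) → Fin κ
    component = proj₁ classes

    component-onto : ∀ c → ∃[ a ] component a ≡ c
    component-onto = proj₁ (proj₂ classes)

    adj⇒component-≡ : ∀ {a b} → Adj G (vertex a) (vertex b) → component a ≡ component b
    adj⇒component-≡ adj = Equivalence.to (proj₂ (proj₂ classes) _ _) (adj ◅ Star.ε)

all-≡⇒≤1 : ∀ {k} → (∀ (c d : Fin k) → c ≡ d) → k ℕ.≤ 1
all-≡⇒≤1 {zero}        _  = z≤n
all-≡⇒≤1 {suc zero}    _  = s≤s z≤n
all-≡⇒≤1 {suc (suc k)} eq with () ← eq zero (suc zero)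

-- Isolated vertices in graphs partitioned into cliques

CliqueCells : ∀ c ℓ → Graph (c ℕ.* ℓ) → Set
CliqueCells c ℓ G = ∀ x {p q} → p ≢ q → Adj G (combine {c} {ℓ} x p) (combine x q)

module _ {c h} (G : Graph (c ℕ.* suc h)) (cells : CliqueCells c (suc h) G)
  (S : Subset (c ℕ.* suc h)) where
  open Deletion G S

  private
    n′ = iso (G ∖ S)

    cell : Fin n′ → Fin c
    cell a = quotient (suc h) (isolated a)

    pos : Fin n′ → Fin (suc h)
    pos a = remainder {c} (suc h) (isolated a)

    combine-cell-pos : ∀ a → combine (cell a) (pos a) ≡ isolated a
    combine-cell-pos a = Fin.combine-remQuot {c} (suc h) (isolated a)

    mate : Fin n′ → Fin h → Fin (c ℕ.* suc h)
    mate a t = combine (cell a) (punchIn (pos a) t)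

    adjacent : ∀ a {x q} → x ≡ cell a → q ≢ pos a → Adj G (isolated a) (combine x q)
    adjacent a {q = q} refl q≢ =
      subst (λ v → Adj G v (combine (cell a) q)) (combine-cell-pos a) (cells (cell a) (q≢ ∘ sym))

    mate∈S : ∀ a t → mate a t ∈ S
    mate∈S a t = neighbour-of-isolated∈S a (adjacent a refl (Fin.punchInᵢ≢i (pos a) t))

    cell-injective : ∀ {a b} → cell a ≡ cell b → a ≡ b
    cell-injective {a} {b} eq with pos a Fin.≟ pos b
    ... | yes p = isolated-injective
      (trans (sym (combine-cell-pos a)) (trans (cong₂ combine eq p) (combine-cell-pos b)))
    ... | no ¬p = contradiction (neighbour-of-isolated∈S b (subst (Adj G _) (combine-cell-pos a)
      (adjacent b eq ¬p))) (vertex∉S _)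

    mate-injective : ∀ {a b t u} → mate a t ≡ mate b u → a ≡ b × t ≡ u
    mate-injective {a} {b} eq
      with eqᶜ , eqᵖ ← Fin.combine-injective (cell a) _ (cell b) _ eq
      with refl ← cell-injective {a} {b} eqᶜ = refl , Fin.punchIn-injective (pos a) _ _ eqᵖ

  -- A vertex can become isolated only if the `h` other vertices of its clique are deleted. It
  -- survives itself, so each clique contains at most one such vertex, and the deleted mates of
  -- different ones are distinct.
  iso*h≤∣S∣ : iso (G ∖ S) ℕ.* h ℕ.≤ ∣ S ∣
  iso*h≤∣S∣ = subst (n′ ℕ.* h ℕ.≤_) (ℕ.*-identityʳ _) (injective⇒≤∣S∣*d {d = 1}
    (λ x → mate (quotient {n′} h x) (remainder {n′} h x)) (λ _ → zero) (λ _ → mate∈S _ _)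
    (λ eq _ → let eqᑫ , eqʳ = mate-injective eq in remQuot-injective {n′} {h} eqᑫ eqʳ))

-- The construction

0<bit⇒ : ∀ {A : Set} (a? : Dec A) → 0 ℕ.< bit (does a?) → A
0<bit⇒ (yes a) _ = a

module _ {n} {_~_ : Rel (Fin n) 0ℓ} (_~?_ : Decidable _~_) (~-sym : Symmetric _~_) where

  adjacent? : ∀ u v → Dec (u ≢ v × u ~ v)
  adjacent? u v = ¬? (u Fin.≟ v) ×-dec (u ~? v)

  simpleGraph : Graph n
  simpleGraph .mult u v     = bit (does (adjacent? u v))
  simpleGraph .mult-sym u v = cong bit (does-⇔ (mk⇔ flip flip) (adjacent? u v) (adjacent? v u))
    where
    flip : ∀ {u v} → u ≢ v × u ~ v → v ≢ u × v ~ u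
    flip (u≢v , u~v) = u≢v ∘ sym , ~-sym u~v
  simpleGraph .loopless v   = cong bit (dec-false (adjacent? v v) λ (v≢v , _) → v≢v refl)

  simpleGraph-≤1 : ∀ u v → mult simpleGraph u v ℕ.≤ 1
  simpleGraph-≤1 u v with does (adjacent? u v)
  ... | true  = s≤s z≤n
  ... | false = z≤n

  simpleGraph-adj : ∀ {u v} → u ≢ v → u ~ v → Adj simpleGraph u v
  simpleGraph-adj {u} {v} u≢v u~v =
    subst (λ b → 0 ℕ.< bit b) (sym (dec-true (adjacent? u v) (u≢v , u~v))) z<s

  simpleGraph-adj⁻ : ∀ {u v} → Adj simpleGraph u v → u ≢ v × u ~ v
  simpleGraph-adj⁻ {u} {v} = 0<bit⇒ (adjacent? u v)

module Construction (m k : ℕ) where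

  -- A clique has at least three vertices, which leaves room for three distinct ports `s ↑ˡ k`. The
  -- cells are the hub and ten cliques for each Petersen copy.
  ℓ cells order : ℕ
  ℓ     = 3 ℕ.+ k
  cells = suc (m ℕ.* 10)
  order = cells ℕ.* ℓ

  data Place : Set where
    hub  : Fin ℓ → Place
    node : (i : Fin m) (b : Fin 10) (p : Fin ℓ) → Place

  node-injective : ∀ {i j b c p q} → node i b p ≡ node j c q → i ≡ j × b ≡ c × p ≡ q
  node-injective refl = refl , refl , refl

  inCell : Fin cells → Fin ℓ → Place
  inCell zero    p = hub p
  inCell (suc z) p = node (quotient 10 z) (remainder {m} 10 z) p

  abstract
    place : Fin order → Place
    place v = inCell (quotient {cells} ℓ v) (remainder {cells} ℓ v)

    cell : Fin m → Fin 10 → Fin cells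
    cell i b = suc (combine i b)

    at : Place → Fin order
    at (hub p)      = combine {cells} zero p
    at (node i b p) = combine {cells} (cell i b) p

    at-inCell : ∀ x p → at (inCell x p) ≡ combine x p
    at-inCell zero    p = refl
    at-inCell (suc z) p = cong (λ y → combine {cells} (suc y) p) (Fin.combine-remQuot {m} 10 z)

    at-place : ∀ v → at (place v) ≡ v
    at-place v = trans (at-inCell (quotient {cells} ℓ v) _) (Fin.combine-remQuot {cells} ℓ v)

    place-combine : ∀ x p → place (combine {cells} x p) ≡ inCell x p
    place-combine x p = cong (λ xp → inCell (proj₁ xp) (proj₂ xp)) (Fin.remQuot-combine {cells} x p)

    place-at : ∀ x → place (at x) ≡ x
    place-at (hub p)      = place-combine zero p
    place-at (node i b p) = trans (place-combine (cell i b) p)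
      (cong (λ ib → node (proj₁ ib) (proj₂ ib) p) (Fin.remQuot-combine {m} i b))

  at-injective : ∀ {x y} → at x ≡ at y → x ≡ y
  at-injective {x} {y} eq = trans (sym (place-at x)) (trans (cong place eq) (place-at y))

  is-at : ∀ {v x} → place v ≡ x → v ≡ at x
  is-at {v} eq = trans (sym (at-place v)) (cong at eq)

  -- The bags of the roots of all gadgets are merged.
  bag : Fin m → Fin 10 → Maybe (Fin m × Fin 9)
  bag i zero    = nothing
  bag i (suc b) = just (i , b)

  bag-injective : ∀ {i j b c} → bag i (suc b) ≡ bag j c → i ≡ j × suc b ≡ c
  bag-injective {c = suc c} refl = refl , refl

  -- Both vertices are ports of the same Petersen edge. This also relates a port to itself, a loop
  -- that `simpleGraph` discards.
  Linked : Fin 10 → Fin ℓ → Fin 10 → Fin ℓ → Set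
  Linked b p c q = ∃₂ λ s t → p ≡ s ↑ˡ k × q ≡ t ↑ˡ k × edge b s ≡ edge c t

  Touch : Rel Place 0ℓ
  Touch (hub _)      _            = ⊤
  Touch (node _ _ _) (hub _)      = ⊤
  Touch (node i b p) (node j c q) = bag i b ≡ bag j c ⊎ (i ≡ j × Linked b p c q)

  touch? : Decidable Touch
  touch? (hub _)      _            = yes tt
  touch? (node _ _ _) (hub _)      = yes tt
  touch? (node i b p) (node j c q) =
    Maybe.≡-dec (Product.≡-dec Fin._≟_ Fin._≟_) (bag i b) (bag j c) ⊎-dec
    (i Fin.≟ j ×-dec Fin.any? λ s → Fin.any? λ t →
      p Fin.≟ s ↑ˡ k ×-dec q Fin.≟ t ↑ˡ k ×-dec edge b s Fin.≟ edge c t)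

  touch-sym : Symmetric Touch
  touch-sym {hub _}      {hub _}      _           = tt
  touch-sym {hub _}      {node _ _ _} _           = tt
  touch-sym {node _ _ _} {hub _}      _           = tt
  touch-sym {node _ _ _} {node _ _ _} (inj₁ eq)   = inj₁ (sym eq)
  touch-sym {node _ _ _} {node _ _ _} (inj₂ (i≡j , s , t , p≡ , q≡ , eq)) =
    inj₂ (sym i≡j , t , s , q≡ , p≡ , sym eq)

  touch-hub : ∀ x p → Touch x (hub p)
  touch-hub (hub _)      _ = tt
  touch-hub (node _ _ _) _ = tt

  _~_ : Rel (Fin order) 0ℓ
  u ~ v = Touch (place u) (place v)

  _~?_ : Decidable _~_
  u ~? v = touch? (place u) (place v)

  abstract
    graph : Graph order
    graph = simpleGraph _~?_ (λ {u} {v} → touch-sym {place u} {place v})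

    graph-≤1 : ∀ u v → mult graph u v ℕ.≤ 1
    graph-≤1 = simpleGraph-≤1 _~?_ (λ {u} {v} → touch-sym {place u} {place v})

    adj : ∀ {u v} → u ≢ v → u ~ v → Adj graph u v
    adj = simpleGraph-adj _~?_ (λ {u} {v} → touch-sym {place u} {place v})

    adj⁻ : ∀ {u v} → Adj graph u v → u ≢ v × u ~ v
    adj⁻ = simpleGraph-adj⁻ _~?_ (λ {u} {v} → touch-sym {place u} {place v})

    touch-inCell : ∀ x p q → Touch (inCell x p) (inCell x q)
    touch-inCell zero    p q = tt
    touch-inCell (suc _) p q = inj₁ refl

    cells-clique : CliqueCells cells ℓ graph
    cells-clique x {p} {q} p≢q = adj (p≢q ∘ Fin.combine-injectiveʳ x p x q)
      (subst₂ Touch (sym (place-combine x p)) (sym (place-combine x q)) (touch-inCell x p q))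

  port : Fin m → Fin 10 → Fin 3 → Fin order
  port i b s = at (node i b (s ↑ˡ k))

  port-injective : ∀ {i j b c s t} → port i b s ≡ port j c t → i ≡ j × b ≡ c × s ≡ t
  port-injective {s = s} {t} eq with i≡j , b≡c , p≡q ← node-injective (at-injective eq) =
    i≡j , b≡c , Fin.↑ˡ-injective k s t p≡q

  hub≢port : ∀ {p i b s} → at (hub p) ≢ port i b s
  hub≢port {p} {i} {b} {s} eq with () ← at-injective {hub p} {node i b (s ↑ˡ k)} eq

-- Toughness

-- `punchIn` for an `n` that is not syntactically a successor, as is the case for a number of
-- components.
others : ∀ {n} → Fin n → Fin (pred n) → Fin n
others {suc n} = punchIn

others≢ : ∀ {n} (c : Fin n) a → others c a ≢ c
others≢ {suc n} = Fin.punchInᵢ≢i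

others-injective : ∀ {n} (c : Fin n) {a b} → others c a ≡ others c b → a ≡ b
others-injective {suc n} c = Fin.punchIn-injective c _ _

module Toughness (m k : ℕ) (S : Subset (Construction.order m k))
  {κ} (classes : Classes (Joined (Construction.graph m k ∖ S)) κ) where
  open Construction m k
  open Deletion graph S
  open Components classes

  touch⇒component-≡ : ∀ {a b} → vertex a ~ vertex b → component a ≡ component b
  touch⇒component-≡ {a} {b} a~b with vertex a Fin.≟ vertex b
  ... | yes eq = cong component (vertex-injective eq)
  ... | no neq = adj⇒component-≡ (adj neq a~b)

  component-unique : (∀ a b → component a ≡ component b) → κ ℕ.≤ 1
  component-unique eq = all-≡⇒≤1 λ c d →
    let a , a↦c = component-onto c
        b , b↦d = component-onto d
    in trans (sym a↦c) (trans (eq a b) b↦d)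

  hub∉S⇒κ≤1 : ∀ p → at (hub p) ∉ S → κ ℕ.≤ 1
  hub∉S⇒κ≤1 p hub∉S = component-unique λ a b → trans (to-hub a) (sym (to-hub b))
    where
    h = index hub∉S
    to-hub : ∀ a → component a ≡ component (proj₁ h)
    to-hub a = touch⇒component-≡ (subst (Touch (place (vertex a)))
      (sym (trans (cong place (proj₂ h)) (place-at (hub p)))) (touch-hub _ p))

  In : Fin m → Fin 10 → Fin (length (remaining S)) → Set
  In i b a = ∃ λ p → place (vertex a) ≡ node i b p

  same-bag : ∀ {i j b c a a′} → In i b a → In j c a′ → bag i b ≡ bag j c →
             component a ≡ component a′
  same-bag (p , eqa) (q , eqb) eq =
    touch⇒component-≡ (subst₂ Touch (sym eqa) (sym eqb) (inj₁ eq))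

  port-index : ∀ {i b s} → port i b s ∉ S → ∃ λ a → place (vertex a) ≡ node i b (s ↑ˡ k)
  port-index p∉S = let a , eq = index p∉S in a , trans (cong place eq) (place-at _)

  record ReachesRoot (a : Fin (length (remaining S))) : Set where
    constructor reaches
    field
      {gadget} : Fin m
      {end}    : Fin (length (remaining S))
      in-root  : In gadget zero end
      joined   : component a ≡ component end

  -- The climb from `a` along tree `t` stops at `top`, because the edge from its bag to the parent
  -- bag has lost an end. The deleted port may be at either end, so it is tied to the child only
  -- through the number of the edge.
  record CutBelow (t : Fin 5) (a : Fin (length (remaining S))) : Set where
    constructor cutBelow
    field
      {gadget} : Fin m
      {child}  : Fin 9
      {top}    : Fin (length (remaining S))
      in-child : In gadget (suc child) top
      joined   : component a ≡ component top
      {bag′}   : Fin 10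
      {port′}  : Fin 3
      cut∈S    : port gadget bag′ port′ ∈ S
      cut-edge : edge bag′ port′ ≡ upEdge t child

  -- While both ends of the edge to the parent survive, one can step inside the bag, which is a
  -- clique, to the lower port and then cross to the parent bag without leaving the component.
  climb : ∀ t d {i b} a → In i b a → ancestor t d b ≡ zero → ReachesRoot a ⊎ CutBelow t a
  climb t d       {b = zero}      a in-b _   = inj₁ (reaches in-b refl)
  climb t (suc d) {i} {b = suc b} a in-b anc
    with port i (suc b) (up t b) ∈? S
       | port i (neighbour (suc b) (up t b)) (swap (up t b)) ∈? S
  ... | yes ∈S | _      = inj₂ (cutBelow in-b refl ∈S refl)
  ... | no  _  | yes ∈S = inj₂ (cutBelow in-b refl ∈S (edge-neighbour (suc b) (up t b)))
  ... | no ∉S  | no ∉S′ with a₁ , eq₁ ← port-index ∉S | a₂ , eq₂ ← port-index ∉S′ =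
    [ (λ (reaches in-root j) → inj₁ (reaches in-root (trans step j)))
    , (λ (cutBelow in-child j ∈S eq) → inj₂ (cutBelow in-child (trans step j) ∈S eq))
    ]′ (climb t d a₂ (_ , eq₂) anc)
    where
    step : component a ≡ component a₂
    step = trans (same-bag in-b (_ , eq₁) refl)
      (touch⇒component-≡ (subst₂ Touch (sym eq₁) (sym eq₂)
        (inj₂ (refl , up t b , swap (up t b) , refl , refl ,
          sym (edge-neighbour (suc b) (up t b))))))

  module _ (hub⊆S : ∀ p → at (hub p) ∈ S) (c₀ : Fin κ) where

    in-node : ∀ a → ∃₂ λ i b → In i b a
    in-node a with place (vertex a) in eq
    ... | node i b p = i , b , p , refl
    ... | hub p = contradiction
      (subst (_∈ S) (sym (is-at eq)) (hub⊆S p)) (vertex∉S a)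

    abstract
      -- The merged root bags form one clique, so their surviving vertices lie in a single
      -- component. If none survives, no component reaches the root and the default `c₀` serves.
      root-component : ∃ λ c → ∀ a → component a ≢ c → ¬ ReachesRoot a
      root-component with Fin.any? (λ i → Fin.any? λ p → ¬? (at (node i zero p) ∈? S))
      ... | no none = c₀ , λ _ _ (reaches {i} {a} (p , eq) _) →
        none (i , p , subst (_∉ S) (is-at eq) (vertex∉S a))
      ... | yes (i , p , ∉S) with index ∉S
      ... | a′ , eq = component a′ , λ a a≢a′ (reaches in-root joined) →
        a≢a′ (trans joined
          (same-bag {j = i} {c = zero} in-root (p , trans (cong place eq) (place-at _)) refl))

    w : ℕ
    w = pred κ

    representative : Fin w → Fin (length (remaining S))
    representative x = proj₁ (component-onto (others (proj₁ root-component) x))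

    component-representative : ∀ x → component (representative x) ≡ others (proj₁ root-component) x
    component-representative x = proj₂ (component-onto (others (proj₁ root-component) x))

    abstract
      cut : ∀ t x → CutBelow t (representative x)
      cut t x with i , b , in-b ← in-node (representative x)
        with climb t 5 (representative x) in-b (ancestor₅≡root t b)
      ... | inj₁ root = contradiction root (proj₂ root-component _ λ eq →
        others≢ (proj₁ root-component) x (trans (sym (component-representative x)) eq))
      ... | inj₂ c = c

    module Cut t x = CutBelow (cut t x)

    -- The surviving vertices of a bag are pairwise adjacent, so a bag meets at most one component,
    -- whichever trees led to it.
    same-child : ∀ t l {x y} → Cut.gadget t x ≡ Cut.gadget l y →
                 Cut.child t x ≡ Cut.child l y → x ≡ y
    same-child t l {x} {y} eqᵍ eqᶜ = others-injective (proj₁ root-component) (begin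
      others (proj₁ root-component) x  ≡⟨ component-representative x ⟨
      component (representative x)     ≡⟨ Cut.joined t x ⟩
      component (Cut.top t x)          ≡⟨ same-bag (Cut.in-child t x) (Cut.in-child l y)
                                            (cong₂ bag eqᵍ (cong suc eqᶜ)) ⟩
      component (Cut.top l y)          ≡⟨ Cut.joined l y ⟨
      component (representative y)     ≡⟨ component-representative y ⟩
      others (proj₁ root-component) y  ∎)
      where open ≡-Reasoning

    w≤m*9 : w ℕ.≤ m ℕ.* 9
    w≤m*9 = Fin.injective⇒≤ {f = λ x → combine (Cut.gadget zero x) (Cut.child zero x)} λ {x} {y} eq →
      let eqᵍ , eqᶜ = Fin.combine-injective (Cut.gadget zero x) _ (Cut.gadget zero y) _ eq
      in same-child zero zero eqᵍ eqᶜ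

    cutVertex : Fin 5 → Fin w → Fin order
    cutVertex t x = port (Cut.gadget t x) (Cut.bag′ t x) (Cut.port′ t x)

    cutSlot : Fin 5 → Fin w → Fin 3
    cutSlot t x = slot t (Cut.child t x)

    -- A deleted port determines its gadget and its edge; the edge and the slot determine the tree
    -- and the child bag; the child bag determines the component.
    cut-injective : ∀ {t l x y} → cutVertex t x ≡ cutVertex l y → cutSlot t x ≡ cutSlot l y →
                    t ≡ l × x ≡ y
    cut-injective {t} {l} {x} {y} eqᵛ eqˢ with eqᵍ , eqᵇ , eqᵖ ← port-injective eqᵛ
      with eqᵗ , eqᶜ ← upEdge-slot-injective t (Cut.child t x) l (Cut.child l y)
        (trans (sym (Cut.cut-edge t x)) (trans (cong₂ edge eqᵇ eqᵖ) (Cut.cut-edge l y))) eqˢ =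
      eqᵗ , same-child t l eqᵍ eqᶜ

    -- The charges: three on every hub vertex, and five from every component other than the one set
    -- aside, one for each tree. No deleted vertex carries more than three.
    Slots : Set
    Slots = Fin (ℓ ℕ.* 3) ⊎ Fin (5 ℕ.* w)

    slotVertex : Slots → Fin order
    slotVertex (inj₁ x) = at (hub (quotient 3 x))
    slotVertex (inj₂ x) = cutVertex (quotient w x) (remainder {5} w x)

    slotNumber : Slots → Fin 3
    slotNumber (inj₁ x) = remainder {ℓ} 3 x
    slotNumber (inj₂ x) = cutSlot (quotient w x) (remainder {5} w x)

    slotVertex∈S : ∀ x → slotVertex x ∈ S
    slotVertex∈S (inj₁ x) = hub⊆S _
    slotVertex∈S (inj₂ x) = Cut.cut∈S (quotient w x) (remainder {5} w x)

    hub-injective : ∀ {p q} → hub p ≡ hub q → p ≡ q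
    hub-injective refl = refl

    slot-injective : ∀ x y → slotVertex x ≡ slotVertex y → slotNumber x ≡ slotNumber y → x ≡ y
    slot-injective (inj₁ x) (inj₁ y) eqᵛ eqⁿ =
      cong inj₁ (remQuot-injective {ℓ} {3} (hub-injective (at-injective {hub _} {hub _} eqᵛ)) eqⁿ)
    slot-injective (inj₁ x) (inj₂ y) eqᵛ _ = contradiction eqᵛ hub≢port
    slot-injective (inj₂ x) (inj₁ y) eqᵛ _ = contradiction (sym eqᵛ) hub≢port
    slot-injective (inj₂ x) (inj₂ y) eqᵛ eqⁿ =
      let eqᵗ , eqˣ = cut-injective eqᵛ eqⁿ in cong inj₂ (remQuot-injective {5} {w} eqᵗ eqˣ)

    3ℓ+5w≤3∣S∣ : 3 ℕ.* ℓ ℕ.+ 5 ℕ.* w ℕ.≤ 3 ℕ.* ∣ S ∣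
    3ℓ+5w≤3∣S∣ = subst₂ ℕ._≤_ (cong (ℕ._+ 5 ℕ.* w) (ℕ.*-comm ℓ 3)) (ℕ.*-comm ∣ S ∣ 3)
      (injective⇒≤∣S∣*d (slotVertex ∘ splitAt (ℓ ℕ.* 3)) (slotNumber ∘ splitAt (ℓ ℕ.* 3))
        (slotVertex∈S ∘ splitAt (ℓ ℕ.* 3))
        (λ eqᵛ eqⁿ → splitAt-injective (slot-injective _ _ eqᵛ eqⁿ)))
      where
      splitAt-injective : ∀ {x y : Fin (ℓ ℕ.* 3 ℕ.+ 5 ℕ.* w)} →
                          splitAt (ℓ ℕ.* 3) x ≡ splitAt (ℓ ℕ.* 3) y → x ≡ y
      splitAt-injective {x} {y} eq = trans (sym (Fin.join-splitAt (ℓ ℕ.* 3) (5 ℕ.* w) x))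
        (trans (cong (join (ℓ ℕ.* 3) (5 ℕ.* w)) eq) (Fin.join-splitAt (ℓ ℕ.* 3) (5 ℕ.* w) y))

  -- A surviving hub vertex is adjacent to everything, so two components can occur only when the
  -- whole hub is deleted.
  tough : κ ℕ.≤ 1 ⊎ (pred κ ℕ.≤ m ℕ.* 9 × 3 ℕ.* ℓ ℕ.+ 5 ℕ.* pred κ ℕ.≤ 3 ℕ.* ∣ S ∣)
  tough with κ ℕ.≤? 1 | Fin.any? (λ p → ¬? (at (hub p) ∈? S))
  ... | yes κ≤1 | _              = inj₁ κ≤1
  ... | no _    | yes (p , hub∉) = inj₁ (hub∉S⇒κ≤1 p hub∉)
  ... | no κ≰1  | no none        = inj₂ (w≤m*9 hub⊆S c₀ , 3ℓ+5w≤3∣S∣ hub⊆S c₀)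
    where
    hub⊆S : ∀ p → at (hub p) ∈ S
    hub⊆S p = decidable-stable (at (hub p) ∈? S) λ hub∉ → none (p , hub∉)
    c₀ : Fin κ
    c₀ = fromℕ< (ℕ.≰⇒> κ≰1)

-- Connected factors

sum-const : ∀ n c → sum {n} (λ _ → c) ≡ n ℕ.* c
sum-const zero    c = refl
sum-const (suc n) c = cong (c ℕ.+_) (sum-const n c)

module NoFactor (m k r : ℕ) (m>ℓ*2r : (3 ℕ.+ k) ℕ.* (2 ℕ.* r) ℕ.< m)
  (F : Graph (Construction.order m k)) (F⊆ : F SpanningSubgraphOf Construction.graph m k)
  (degree≤2r : ∀ v → degree F v ℕ.≤ 2 ℕ.* r) (degree-even : ∀ v → 2 ∣ degree F v)
  where
  open Construction m k

  F≤1 : ∀ u v → mult F u v ℕ.≤ 1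
  F≤1 u v = ℕ.≤-trans (F⊆ u v) (graph-≤1 u v)

  HubEdge : Fin m → Set
  HubEdge i = ∃ λ p → ∃₂ λ b q → Adj F (at (hub p)) (at (node i b q))

  hubEdge? : ∀ i → Dec (HubEdge i)
  hubEdge? i = Fin.any? λ p → Fin.any? λ b → Fin.any? λ q → 0 ℕ.<? _

  -- Hub edges chosen from different gadgets have different ends, so the hub degrees would add up to
  -- at least `m`, against the bound `ℓ * (2 * r)`.
  not-all-hubEdges : ¬ (∀ i → HubEdge i)
  not-all-hubEdges edges = ℕ.<⇒≱ m>ℓ*2r (begin
    m
      ≡⟨ ℕ.*-identityʳ m ⟨
    m ℕ.* 1
      ≡⟨ sum-const m 1 ⟨
    sum {m} (λ _ → 1)
      ≤⟨ sum-mono-≤ (λ i → let p , _ , _ , edge = edges i in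
           ℕ.≤-trans edge (term≤sum (λ p → mult F (at (hub p)) (end i)) p)) ⟩
    sum (λ i → sum (λ p → mult F (at (hub p)) (end i)))
      ≡⟨ ∑-comm (λ i p → mult F (at (hub p)) (end i)) ⟩
    sum (λ p → sum (λ i → mult F (at (hub p)) (end i)))
      ≤⟨ sum-mono-≤ (λ p → sum-∘-≤ (mult F (at (hub p))) end end-injective) ⟩
    sum (λ p → degree F (at (hub p)))
      ≤⟨ sum-mono-≤ (λ p → degree≤2r (at (hub p))) ⟩
    sum {ℓ} (λ _ → 2 ℕ.* r)
      ≡⟨ sum-const ℓ (2 ℕ.* r) ⟩
    ℓ ℕ.* (2 ℕ.* r) ∎)
    where
    open ℕ.≤-Reasoning
    end : Fin m → Fin order
    end i = let _ , b , q , _ = edges i in at (node i b q)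
    end-injective : ∀ {i j} → end i ≡ end j → i ≡ j
    end-injective = proj₁ ∘ node-injective ∘ at-injective

  quiet-gadget : ∃ λ i → ¬ HubEdge i
  quiet-gadget = Fin.¬∀⟶∃¬ m HubEdge hubEdge? not-all-hubEdges

  module Quiet {i} (quiet : ¬ HubEdge i) where

    opposite : Fin 10 → Fin 3 → Fin order
    opposite b s = port i (neighbour b s) (swap s)

    -- Quietness excludes the hub, and a non-root bag is not merged with any other, so the bag can
    -- be left only along one of its three Petersen edges.
    exit : ∀ {u v b p} → place u ≡ node i (suc b) p → Adj F u v →
      (∃ λ q → place v ≡ node i (suc b) q) ⊎
      (∃ λ s → u ≡ port i (suc b) s × v ≡ opposite (suc b) s)
    exit {u} {v} {b} {p} eqᵘ uv
      with place v in eqᵛ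
         | subst (λ x → Touch x (place v)) eqᵘ (proj₂ (adj⁻ (ℕ.<-≤-trans uv (F⊆ u v))))
    ... | hub q | _ = contradiction (q , suc b , p , subst₂ (Adj F) (is-at eqᵛ) (is-at eqᵘ)
      (subst (0 ℕ.<_) (mult-sym F u v) uv)) quiet
    ... | node j c q | inj₁ same
      with refl , refl ← bag-injective {b = b} {c = c} same = inj₁ (q , refl)
    ... | node j c q | inj₂ (refl , s , t , refl , refl , eq) with edge-ends (suc b) s c t eq
    ... | inj₁ (refl , refl) = inj₁ (q , refl)
    ... | inj₂ (refl , refl) = inj₂ (s , is-at eqᵘ , is-at eqᵛ)

    crosses : Fin 10 → Fin 3 → ℕ
    crosses b s = mult F (port i b s) (opposite b s)

    crosses-neighbour : ∀ b s → crosses (neighbour b s) (swap s) ≡ crosses b s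
    crosses-neighbour b s = trans (mult-sym F _ _)
      (cong₂ (λ c t → mult F (port i c t) (opposite b s)) (neighbour-involutive b s) (swap-involutive s))

    -- `edge-onto` picks one end of the edge; by `crosses-neighbour` the other end gives the same
    -- value.
    usedAt : Fin 15 → ℕ
    usedAt e = let b , s , _ = edge-onto e in crosses b s

    usedAt-edge : ∀ b s → usedAt (edge b s) ≡ crosses b s
    usedAt-edge b s = let c , t , eq = edge-onto (edge b s) in ends (edge-ends b s c t (sym eq))
      where
      ends : ∀ {c t} → (c ≡ b × t ≡ s) ⊎ (c ≡ neighbour b s × t ≡ swap s) → crosses c t ≡ crosses b s
      ends (inj₁ (refl , refl)) = refl
      ends (inj₂ (refl , refl)) = crosses-neighbour b s

    bit-0< : ∀ {n} → n ℕ.≤ 1 → bit (does (0 ℕ.<? n)) ≡ n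
    bit-0< z≤n       = refl
    bit-0< (s≤s z≤n) = refl

    isUsed : Fin 15 → Bool
    isUsed e = does (0 ℕ.<? usedAt e)

    abstract
      used : Subset 15
      used = Vec.tabulate isUsed

      -- `F` has no multiple edges, so recording only whether an edge is used keeps its
      -- multiplicity, and with it the parity of sums.
      bit-used : ∀ b s → bit (Vec.lookup used (edge b s)) ≡ crosses b s
      bit-used b s = begin
        bit (Vec.lookup used (edge b s))        ≡⟨ cong bit (lookup∘tabulate isUsed (edge b s)) ⟩
        bit (does (0 ℕ.<? usedAt (edge b s)))   ≡⟨ bit-0< (F≤1 _ _) ⟩
        usedAt (edge b s)                       ≡⟨ usedAt-edge b s ⟩
        crosses b s                             ∎
        where open ≡-Reasoning

    crosses⇒used : ∀ {b s} → 0 ℕ.< crosses b s → edge b s ∈ used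
    crosses⇒used {b} {s} pos = lookup⇒[]= (edge b s) used
      (bit-true (subst (0 ℕ.<_) (sym (bit-used b s)) pos))
      where
      bit-true : ∀ {x} → 0 ℕ.< bit x → x ≡ true
      bit-true {true} _ = refl

    module _ (b : Fin 9) where

      InBag : Place → Set
      InBag x = ∃ λ q → x ≡ node i (suc b) q

      inBag? : ∀ x → Dec (InBag x)
      inBag? (hub _) = no λ ()
      inBag? (node j c q) = map′ (λ { (refl , refl) → q , refl }) (λ { (_ , refl) → refl , refl })
        (j Fin.≟ i ×-dec c Fin.≟ suc b)

      χ : Fin order → Bool
      χ v = does (inBag? (place v))

      cut-edge : ∀ u v → crossing χ (mult F) u v ≢ 0 →
                 ∃ λ s → u ≡ port i (suc b) s × v ≡ opposite (suc b) s
      cut-edge u v ≢0 with inBag? (place u) | inBag? (place v)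
      ... | no _          | _      = contradiction refl ≢0
      ... | yes _         | yes _  = contradiction refl ≢0
      ... | yes (p , eqᵘ) | no v∉  = [ (λ v∈ → contradiction v∈ v∉) , id ]′
        (exit eqᵘ (ℕ.n≢0⇒n>0 ≢0))

      cut-row : ∀ s → sum (crossing χ (mult F) (port i (suc b) s)) ≡ crosses (suc b) s
      cut-row s = trans
        (sum-∘-≡ {d = 1} (crossing χ (mult F) u) (λ _ → opposite (suc b) s)
          (λ { {zero} {zero} _ → refl }) off)
        (trans (ℕ.+-identityʳ _) value)
        where
        u = port i (suc b) s
        off : ∀ v → (∀ a → opposite (suc b) s ≢ v) → crossing χ (mult F) u v ≡ 0
        off v ≢v = decidable-stable (_ ℕ.≟ 0) λ ≢0 →
          let t , eqᵘ , eqᵛ = cut-edge u v ≢0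
              _ , _ , s≡t = port-injective {s = s} eqᵘ
          in ≢v zero (trans (cong (opposite (suc b)) s≡t) (sym eqᵛ))
        value : crossing χ (mult F) u (opposite (suc b) s) ≡ crosses (suc b) s
        value with inBag? (place u) | inBag? (place (opposite (suc b) s))
        ... | no u∉ | _ = contradiction (_ , place-at _) u∉
        ... | yes _ | yes (q , eq) = contradiction
          (proj₁ (proj₂ (node-injective (trans (sym (place-at _)) eq)))) (neighbour≢ (suc b) s)
        ... | yes _ | no _ = refl

      -- The cut around the bag is even by `2∣cut`, and by `exit` it consists of the edges of `F` at
      -- the three ports.
      even-at : EvenAt used (suc b)
      even-at = subst (2 ∣_) (begin
        sum (λ u → sum (crossing χ (mult F) u))
          ≡⟨ sum-∘-≡ _ (port i (suc b)) (proj₂ ∘ proj₂ ∘ port-injective) off ⟩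
        sum (λ s → sum (crossing χ (mult F) (port i (suc b) s)))
          ≡⟨ sum-cong-≗ (λ s → trans (cut-row s) (sym (bit-used (suc b) s))) ⟩
        sum (λ s → bit (Vec.lookup used (edge (suc b) s))) ∎)
        (2∣cut χ (mult F) (mult-sym F) (loopless F) degree-even)
        where
        open ≡-Reasoning
        off : ∀ u → (∀ s → port i (suc b) s ≢ u) → sum (crossing χ (mult F) u) ≡ 0
        off u ≢u = sum-zero λ v → decidable-stable (_ ℕ.≟ 0) λ ≢0 →
          let s , eqᵘ , _ = cut-edge u v ≢0 in ≢u s (sym eqᵘ)

    -- The vertices in the bags of `W` are closed under adjacency in `F`, and the hub lies outside
    -- them.
    isolates⇒disconnected : ∀ {W} → Isolates W used → ¬ Connected F
    isolates⇒disconnected {W} ((b , b∈W) , isolates) connected =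
      hub∉ (closed (b , zero , b∈W , place-at (node i (suc b) zero)) (connected _ (at (hub zero))))
      where
      InW : Fin order → Set
      InW v = ∃₂ λ b p → b ∈ W × place v ≡ node i (suc b) p
      step : ∀ {u v} → InW u → Adj F u v → InW v
      step (b , p , b∈W , eq) uv with exit eq uv
      ... | inj₁ (q , eqᵛ) = b , q , b∈W , eqᵛ
      ... | inj₂ (s , refl , refl)
        with neighbour (suc b) s | isolates b b∈W s (crosses⇒used uv)
      -- The root is ruled out because `outside ∷ W` does not contain it.
      ... | suc c | there c∈W = c , _ , c∈W , place-at _
      closed : ∀ {u v} → InW u → Joined F u v → InW v
      closed u∈ Star.ε    = u∈
      closed u∈ (uv ◅ vw) = closed (step u∈ uv) vw
      hub∉ : ¬ InW (at (hub zero))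
      hub∉ (_ , _ , _ , eq) with () ← trans (sym (place-at (hub zero))) eq

    disconnected : ¬ Connected F
    disconnected = isolates⇒disconnected (proj₂ (even⇒isolates used even-at))

  not-connected : ¬ Connected F
  not-connected = Quiet.disconnected (proj₂ quiet-gadget)

-- Arithmetic

·ℝ-upper : ∀ k (x : ℝ) {c} n → seq x n ≤ c → seq (k ·ℝ x) n ≤ (+ k / 1) * c
·ℝ-upper zero    x {c} n _   = ℚ.≤-reflexive (ℚ.≃-sym (ℚ.*-zeroˡ c))
·ℝ-upper (suc k) x {c} n x≤c = begin
  seq x n + seq (k ·ℝ x) n         ≤⟨ ℚ.+-mono-≤ x≤c (·ℝ-upper k x n x≤c) ⟩
  c + (+ k / 1) * c                ≃⟨ ℚ.+-congˡ ((+ k / 1) * c) (ℚ.*-identityˡ c) ⟨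
  (+ 1 / 1) * c + (+ k / 1) * c    ≃⟨ ℚ.*-distribʳ-+ c (+ 1 / 1) (+ k / 1) ⟨
  ((+ 1 / 1) + (+ k / 1)) * c      ≃⟨ ℚ.*-congʳ {c} {+ 1 / 1 + + k / 1} {+ suc k / 1} (*≡*
                                        (cong (λ z → (+ 1 ℤ.+ z) ℤ.* + 1) (ℤ.*-identityʳ (+ k)))) ⟩
  (+ suc k / 1) * c                ∎
  where open ℚ.≤-Reasoning

-- An eventual rational upper bound `c` of `x` reduces the comparison of reals to one of rationals.
·ℝ-≤-fromℕ : ∀ k {s} (x : ℝ) {c} → ∃[ N ] (∀ n → N ℕ.≤ n → seq x n ≤ c) →
            (+ k / 1) * c ≤ + s / 1 → k ·ℝ x ≤ℝ fromℕ s
·ℝ-≤-fromℕ k {s} x {c} (N , x≤c) kc≤s δ 0<δ = N , λ n N≤n → begin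
  seq (k ·ℝ x) n        ≤⟨ ·ℝ-upper k x n (x≤c n N≤n) ⟩
  (+ k / 1) * c         ≤⟨ kc≤s ⟩
  + s / 1               ≃⟨ ℚ.+-identityʳ (+ s / 1) ⟨
  + s / 1 + 0ℚᵘ         ≤⟨ ℚ.+-monoʳ-≤ (+ s / 1) (ℚ.<⇒≤ 0<δ) ⟩
  + s / 1 + δ           ∎
  where open ℚ.≤-Reasoning

-- Positivity of `ε` comes with a positive rational lower bound `δ`; its numerator is at least 1, so
-- its denominator can be taken.
archimedean : ∀ (ε : ℝ) → 0ℝ <ℝ ε → ∃[ d ] ∃[ N ] (∀ n → N ℕ.≤ n → + 1 / suc d ≤ seq ε n)
archimedean ε (mkℚᵘ (+ zero)  d , *<* (ℤ.+<+ ()) , _)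
archimedean ε (mkℚᵘ (ℤ.-[1+ _ ]) d , *<* () , _)
archimedean ε (δ@(mkℚᵘ (+ suc a) d) , _ , N , δ≤ε) = d , N , λ n N≤n → begin
  + 1 / suc d      ≤⟨ *≤* (ℤ.*-monoʳ-≤-nonNeg (+ suc d) {+ 1} {+ suc a} (ℤ.+≤+ (s≤s z≤n))) ⟩
  δ                ≃⟨ ℚ.+-identityˡ δ ⟨
  0ℚᵘ + δ          ≤⟨ δ≤ε n N≤n ⟩
  seq ε n          ∎
  where open ℚ.≤-Reasoning

-- The hypothesis is the conclusion multiplied by `3 * r * suc d`, with the subtracted term moved
-- across so that it lives in the naturals.
scaled-≤ : ∀ k s r d → .{{_ : NonZero r}} →
  k ℕ.* ((5 ℕ.* r ℕ.+ 3) ℕ.* suc d) ℕ.≤ s ℕ.* (3 ℕ.* r ℕ.* suc d) ℕ.+ k ℕ.* (3 ℕ.* r) →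
  (+ k / 1) * (+ 5 / 3 + + 1 / r - + 1 / suc d) ≤ + s / 1
scaled-≤ k s r@(suc _) d le = *≤* (begin
  + k ℤ.* ((+ 5 ℤ.* R ℤ.+ + 1 ℤ.* + 3) ℤ.* D ℤ.+ ℤ.- + 1 ℤ.* (+ 3 ℤ.* R)) ℤ.* + 1
    ≡⟨ expand (+ k) R D ⟩
  + k ℤ.* ((+ 5 ℤ.* R ℤ.+ + 3) ℤ.* D) ℤ.- + k ℤ.* (+ 3 ℤ.* R)
    ≤⟨ ℤ.+-monoˡ-≤ (ℤ.- (+ k ℤ.* (+ 3 ℤ.* R))) (subst₂ ℤ._≤_ lhs rhs (ℤ.+≤+ le)) ⟩
  + s ℤ.* (+ 3 ℤ.* R ℤ.* D) ℤ.+ + k ℤ.* (+ 3 ℤ.* R) ℤ.- + k ℤ.* (+ 3 ℤ.* R)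
    ≡⟨ cancel (+ s) (+ k) R D ⟩
  + s ℤ.* (+ 1 ℤ.* (+ 3 ℤ.* R ℤ.* D)) ∎)
  where
  open ℤ.≤-Reasoning
  R D : ℤ
  R = + r
  D = + suc d
  expand : ∀ k R D → k ℤ.* ((+ 5 ℤ.* R ℤ.+ + 1 ℤ.* + 3) ℤ.* D ℤ.+ ℤ.- + 1 ℤ.* (+ 3 ℤ.* R)) ℤ.* + 1
    ≡ k ℤ.* ((+ 5 ℤ.* R ℤ.+ + 3) ℤ.* D) ℤ.- k ℤ.* (+ 3 ℤ.* R)
  expand = ℤ-Solver.solve-∀
  cancel : ∀ s k R D → s ℤ.* (+ 3 ℤ.* R ℤ.* D) ℤ.+ k ℤ.* (+ 3 ℤ.* R) ℤ.- k ℤ.* (+ 3 ℤ.* R)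
    ≡ s ℤ.* (+ 1 ℤ.* (+ 3 ℤ.* R ℤ.* D))
  cancel = ℤ-Solver.solve-∀
  lhs : + (k ℕ.* ((5 ℕ.* r ℕ.+ 3) ℕ.* suc d)) ≡ + k ℤ.* ((+ 5 ℤ.* R ℤ.+ + 3) ℤ.* D)
  lhs = trans (ℤ.pos-* k _) (cong (+ k ℤ.*_) (trans (ℤ.pos-* (5 ℕ.* r ℕ.+ 3) (suc d))
    (cong (λ z → (z ℤ.+ + 3) ℤ.* D) (ℤ.pos-* 5 r))))
  rhs : + (s ℕ.* (3 ℕ.* r ℕ.* suc d) ℕ.+ k ℕ.* (3 ℕ.* r))
    ≡ + s ℤ.* (+ 3 ℤ.* R ℤ.* D) ℤ.+ + k ℤ.* (+ 3 ℤ.* R)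
  rhs = cong₂ ℤ._+_
    (trans (ℤ.pos-* s _) (cong (+ s ℤ.*_) (trans (ℤ.pos-* (3 ℕ.* r) (suc d)) (cong (ℤ._* D) (ℤ.pos-* 3 r)))))
    (trans (ℤ.pos-* k _) (cong (+ k ℤ.*_) (ℤ.pos-* 3 r)))

-- The toughness inequality for `suc c` components, where `R` stands for 18r and 1/D for the lower
-- bound of ε. Replacing `3 * s` by its lower bound `few` cancels the terms `5 * c` and leaves
-- `core`.
component-bound : ∀ c s ℓ D R → 18 ℕ.≤ R → 2 ℕ.+ D ℕ.≤ ℓ → c ℕ.≤ R ℕ.* ℓ ℕ.+ 9 →
  3 ℕ.* ℓ ℕ.+ 5 ℕ.* c ℕ.≤ 3 ℕ.* s →
  suc c ℕ.* ((5 ℕ.* R ℕ.+ 3) ℕ.* D) ℕ.≤ s ℕ.* (3 ℕ.* R ℕ.* D) ℕ.+ suc c ℕ.* (3 ℕ.* R)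
component-bound c s ℓ D R 18≤R D+2≤ℓ c≤ few = begin
  suc c ℕ.* ((5 ℕ.* R ℕ.+ 3) ℕ.* D)
    ≡⟨ split c R D ⟩
  R ℕ.* D ℕ.* (5 ℕ.* c) ℕ.+ (5 ℕ.* (R ℕ.* D) ℕ.+ 3 ℕ.* D ℕ.* suc c)
    ≤⟨ ℕ.+-monoʳ-≤ (R ℕ.* D ℕ.* (5 ℕ.* c)) core ⟩
  R ℕ.* D ℕ.* (5 ℕ.* c) ℕ.+ (R ℕ.* D ℕ.* (3 ℕ.* ℓ) ℕ.+ suc c ℕ.* (3 ℕ.* R))
    ≡⟨ merge c R D ℓ ⟩
  R ℕ.* D ℕ.* (3 ℕ.* ℓ ℕ.+ 5 ℕ.* c) ℕ.+ suc c ℕ.* (3 ℕ.* R)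
    ≤⟨ ℕ.+-monoˡ-≤ (suc c ℕ.* (3 ℕ.* R)) (ℕ.*-monoʳ-≤ (R ℕ.* D) few) ⟩
  R ℕ.* D ℕ.* (3 ℕ.* s) ℕ.+ suc c ℕ.* (3 ℕ.* R)
    ≡⟨ cong (ℕ._+ suc c ℕ.* (3 ℕ.* R)) (comm s R D) ⟩
  s ℕ.* (3 ℕ.* R ℕ.* D) ℕ.+ suc c ℕ.* (3 ℕ.* R) ∎
  where
  open ℕ.≤-Reasoning
  split : ∀ c R D → suc c ℕ.* ((5 ℕ.* R ℕ.+ 3) ℕ.* D) ≡
    R ℕ.* D ℕ.* (5 ℕ.* c) ℕ.+ (5 ℕ.* (R ℕ.* D) ℕ.+ 3 ℕ.* D ℕ.* suc c)
  split = solve-∀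
  merge : ∀ c R D ℓ → R ℕ.* D ℕ.* (5 ℕ.* c) ℕ.+ (R ℕ.* D ℕ.* (3 ℕ.* ℓ) ℕ.+ suc c ℕ.* (3 ℕ.* R)) ≡
    R ℕ.* D ℕ.* (3 ℕ.* ℓ ℕ.+ 5 ℕ.* c) ℕ.+ suc c ℕ.* (3 ℕ.* R)
  merge = solve-∀
  comm : ∀ s R D → R ℕ.* D ℕ.* (3 ℕ.* s) ≡ s ℕ.* (3 ℕ.* R ℕ.* D)
  comm = solve-∀
  core : 5 ℕ.* (R ℕ.* D) ℕ.+ 3 ℕ.* D ℕ.* suc c ℕ.≤ R ℕ.* D ℕ.* (3 ℕ.* ℓ) ℕ.+ suc c ℕ.* (3 ℕ.* R)
  core with ℕ.≤-total (3 ℕ.* D) (suc c)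
  -- Many components: the bound on `c` turns the left side into the hub term plus 5RD + 30D, which
  -- is at most 9RD as 30 ≤ 4R, and the ε-term pays for that.
  ... | inj₁ 3D≤c+1 = begin
    5 ℕ.* (R ℕ.* D) ℕ.+ 3 ℕ.* D ℕ.* suc c
      ≤⟨ ℕ.+-monoʳ-≤ (5 ℕ.* (R ℕ.* D)) (ℕ.*-monoʳ-≤ (3 ℕ.* D) (s≤s c≤)) ⟩
    5 ℕ.* (R ℕ.* D) ℕ.+ 3 ℕ.* D ℕ.* suc (R ℕ.* ℓ ℕ.+ 9)
      ≡⟨ e₁ R D ℓ ⟩
    R ℕ.* D ℕ.* (3 ℕ.* ℓ) ℕ.+ (5 ℕ.* (R ℕ.* D) ℕ.+ 30 ℕ.* D)
      ≤⟨ ℕ.+-monoʳ-≤ (R ℕ.* D ℕ.* (3 ℕ.* ℓ)) (ℕ.+-monoʳ-≤ (5 ℕ.* (R ℕ.* D))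
           (ℕ.*-monoˡ-≤ D (ℕ.≤-trans (ℕ.m≤m+n 30 42) (ℕ.*-monoʳ-≤ 4 18≤R)))) ⟩
    R ℕ.* D ℕ.* (3 ℕ.* ℓ) ℕ.+ (5 ℕ.* (R ℕ.* D) ℕ.+ 4 ℕ.* R ℕ.* D)
      ≡⟨ cong (R ℕ.* D ℕ.* (3 ℕ.* ℓ) ℕ.+_) (e₂ R D) ⟩
    R ℕ.* D ℕ.* (3 ℕ.* ℓ) ℕ.+ 3 ℕ.* D ℕ.* (3 ℕ.* R)
      ≤⟨ ℕ.+-monoʳ-≤ (R ℕ.* D ℕ.* (3 ℕ.* ℓ)) (ℕ.*-monoˡ-≤ (3 ℕ.* R) 3D≤c+1) ⟩
    R ℕ.* D ℕ.* (3 ℕ.* ℓ) ℕ.+ suc c ℕ.* (3 ℕ.* R) ∎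
    where
    e₁ : ∀ R D ℓ → 5 ℕ.* (R ℕ.* D) ℕ.+ 3 ℕ.* D ℕ.* suc (R ℕ.* ℓ ℕ.+ 9) ≡
      R ℕ.* D ℕ.* (3 ℕ.* ℓ) ℕ.+ (5 ℕ.* (R ℕ.* D) ℕ.+ 30 ℕ.* D)
    e₁ = solve-∀
    e₂ : ∀ R D → 5 ℕ.* (R ℕ.* D) ℕ.+ 4 ℕ.* R ℕ.* D ≡ 3 ℕ.* D ℕ.* (3 ℕ.* R)
    e₂ = solve-∀
  -- Few components: the left side is at most 5RD + 9DD, and the hub term alone covers it because
  -- `ℓ` is at least D + 2.
  ... | inj₂ c+1≤3D = begin
    5 ℕ.* (R ℕ.* D) ℕ.+ 3 ℕ.* D ℕ.* suc c
      ≤⟨ ℕ.+-monoʳ-≤ (5 ℕ.* (R ℕ.* D)) (ℕ.*-monoʳ-≤ (3 ℕ.* D) c+1≤3D) ⟩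
    5 ℕ.* (R ℕ.* D) ℕ.+ 3 ℕ.* D ℕ.* (3 ℕ.* D)
      ≡⟨ e₁ R D ⟩
    5 ℕ.* (R ℕ.* D) ℕ.+ 9 ℕ.* (D ℕ.* D)
      ≤⟨ ℕ.+-mono-≤ (ℕ.*-monoˡ-≤ (R ℕ.* D) (ℕ.m≤m+n 5 1))
           (ℕ.*-monoˡ-≤ (D ℕ.* D) (ℕ.≤-trans (ℕ.m≤m+n 9 45) (ℕ.*-monoʳ-≤ 3 18≤R))) ⟩
    6 ℕ.* (R ℕ.* D) ℕ.+ 3 ℕ.* R ℕ.* (D ℕ.* D)
      ≡⟨ e₂ R D ⟩
    R ℕ.* D ℕ.* (3 ℕ.* (2 ℕ.+ D))
      ≤⟨ ℕ.*-monoʳ-≤ (R ℕ.* D) (ℕ.*-monoʳ-≤ 3 D+2≤ℓ) ⟩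
    R ℕ.* D ℕ.* (3 ℕ.* ℓ)
      ≤⟨ ℕ.m≤m+n _ _ ⟩
    R ℕ.* D ℕ.* (3 ℕ.* ℓ) ℕ.+ suc c ℕ.* (3 ℕ.* R) ∎
    where
    e₁ : ∀ R D → 5 ℕ.* (R ℕ.* D) ℕ.+ 3 ℕ.* D ℕ.* (3 ℕ.* D) ≡ 5 ℕ.* (R ℕ.* D) ℕ.+ 9 ℕ.* (D ℕ.* D)
    e₁ = solve-∀
    e₂ : ∀ R D → 6 ℕ.* (R ℕ.* D) ℕ.+ 3 ℕ.* R ℕ.* (D ℕ.* D) ≡ R ℕ.* D ℕ.* (3 ℕ.* (2 ℕ.+ D))
    e₂ = solve-∀

-- The family of graphs

gadgets : ℕ → ℕ → ℕ
gadgets r k = suc ((3 ℕ.+ k) ℕ.* (2 ℕ.* r))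

module Member (r k : ℕ) where
  open Construction (gadgets r k) k public

  iso-bound : ∀ h → .{{_ : NonZero h}} → h ℕ.≤ k → ∀ S →
    + iso (graph ∖ S) / 1 ≤ (+ 1 / h) * (+ ∣ S ∣ / 1)
  iso-bound h@(suc _) h≤k S = *≤* (subst₂ ℤ._≤_ (ℤ.pos-* i (h ℕ.* 1)) (sym eq) (ℤ.+≤+ (begin
    i ℕ.* (h ℕ.* 1)  ≡⟨ cong (i ℕ.*_) (ℕ.*-identityʳ h) ⟩
    i ℕ.* h          ≤⟨ ℕ.*-monoʳ-≤ i (ℕ.≤-trans h≤k (ℕ.m≤n+m k 2)) ⟩
    i ℕ.* (2 ℕ.+ k)  ≤⟨ iso*h≤∣S∣ {cells} graph cells-clique S ⟩
    ∣ S ∣            ∎)))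
    where
    open ℕ.≤-Reasoning
    i = iso (graph ∖ S)
    eq : + 1 ℤ.* + ∣ S ∣ ℤ.* + 1 ≡ + ∣ S ∣
    eq = trans (ℤ.*-identityʳ _) (ℤ.*-identityˡ _)

  tough : ∀ d → .{{_ : NonZero r}} → d ℕ.≤ k → ∀ S → ω (graph ∖ S) ℕ.≤ 1 ⊎
    (+ ω (graph ∖ S) / 1) * (+ 5 / 3 + (+ 1 / (18 ℕ.* r)) {{m*n≢0 18 r}} - + 1 / suc d) ≤ + ∣ S ∣ / 1
  tough d d≤k S = bound (ω (graph ∖ S))
    (Toughness.tough (gadgets r k) k S (proj₂ (components (graph ∖ S))))
    where
    bound : ∀ κ →
      κ ℕ.≤ 1 ⊎ (pred κ ℕ.≤ gadgets r k ℕ.* 9 × 3 ℕ.* ℓ ℕ.+ 5 ℕ.* pred κ ℕ.≤ 3 ℕ.* ∣ S ∣) →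
      κ ℕ.≤ 1 ⊎ (+ κ / 1) * (+ 5 / 3 + (+ 1 / (18 ℕ.* r)) {{m*n≢0 18 r}} - + 1 / suc d) ≤ + ∣ S ∣ / 1
    bound κ (inj₁ κ≤1) = inj₁ κ≤1
    bound zero (inj₂ _) = inj₁ z≤n
    -- Nine non-root bags in each of the 2rℓ + 1 gadgets give `c ≤ R * ℓ + 9` with R = 18r, which is
    -- where the term 1/(18r) comes from.
    bound (suc c) (inj₂ (c≤ , few)) = inj₂ (scaled-≤ (suc c) ∣ S ∣ (18 ℕ.* r) d {{m*n≢0 18 r}}
      (component-bound c ∣ S ∣ ℓ (suc d) (18 ℕ.* r) (ℕ.m≤m*n 18 r)
        (ℕ.+-monoʳ-≤ 3 d≤k) (ℕ.≤-trans c≤ (ℕ.≤-reflexive (gadgets*9 r k))) few))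
      where
      gadgets*9 : ∀ r k → suc ((3 ℕ.+ k) ℕ.* (2 ℕ.* r)) ℕ.* 9 ≡ 18 ℕ.* r ℕ.* (3 ℕ.+ k) ℕ.+ 9
      gadgets*9 = solve-∀

  no-factor : ¬ HasConnectedFactor (evens r) graph
  no-factor (F , (F⊆ , even) , connected) = NoFactor.not-connected (gadgets r k) k r ℕ.≤-refl F F⊆
    (λ v → let i , _ , i≤r , eq = even v
           in subst (ℕ._≤ 2 ℕ.* r) (sym (ℤ.+-injective eq)) (ℕ.*-monoʳ-≤ 2 i≤r))
    (λ v → let i , _ , _ , eq = even v in subst (2 ∣_) (sym (ℤ.+-injective eq)) (m∣m*n i))
    connected

order-mono-< : ∀ r → .{{_ : NonZero r}} → ∀ {k l} → k ℕ.< l → Member.order r k ℕ.< Member.order r l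
order-mono-< r@(suc _) k<l = ℕ.*-mono-<
  (s≤s (ℕ.*-monoˡ-< 10 (s≤s (ℕ.*-monoˡ-< (2 ℕ.* r) (ℕ.+-monoʳ-< 3 k<l)))))
  (ℕ.+-monoʳ-< 3 k<l)

-- Isomorphic graphs have the same order, so different parameters give non-isomorphic graphs.
order-injective : ∀ r → .{{_ : NonZero r}} → ∀ {k l} → Member.order r k ≡ Member.order r l → k ≡ l
order-injective r {k} {l} eq with ℕ.<-cmp k l
... | tri< k<l _ _ = contradiction eq (ℕ.<⇒≢ (order-mono-< r k<l))
... | tri≈ _ k≡l _ = k≡l
... | tri> _ _ l<k = contradiction (sym eq) (ℕ.<⇒≢ (order-mono-< r l<k))

mainTheorem20 : (r h : ℕ) .{{_ : NonZero r}} .{{_ : NonZero h}} (ε : ℝ) → 0ℝ <ℝ ε →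
    InfinitelyManyGraphs (λ {n} G →
    ((S : Subset n) → + iso (G ∖ S) / 1 ≤ (+ 1 / h) * (+ ∣ S ∣ / 1)) ×
    Tough (fromℚ (+ 5 / 3 + (+ 1 / (18 ℕ.* r)) {{m*n≢0 18 r}}) -ℝ ε) G ×
    ¬ HasConnectedFactor (evens r) G)
mainTheorem20 r h ε 0<ε =
  (λ i → Member.order r (size i) , Member.graph r (size i)) ,
  (λ i j (φ , _) → ℕ.+-cancelˡ-≡ (h ℕ.+ d) i j (order-injective r (↔⇒≡ φ))) ,
  (λ i → Member.iso-bound r (size i) h (ℕ.m≤n⇒m≤n+o i (ℕ.m≤m+n h d)) ,
         tough i ,
         Member.no-factor r (size i))
  where
  d = proj₁ (archimedean ε 0<ε)
  N = proj₁ (proj₂ (archimedean ε 0<ε))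
  -- At least `h` for the bound on isolated vertices, at least `d` for toughness, and injective in
  -- `i`.
  size : ℕ → ℕ
  size i = h ℕ.+ d ℕ.+ i
  q c : ℚᵘ
  q = + 5 / 3 + (+ 1 / (18 ℕ.* r)) {{m*n≢0 18 r}}
  c = q - + 1 / suc d
  t : ℝ
  t = fromℚ q -ℝ ε
  t≤c : ∀ n → N ℕ.≤ n → seq t n ≤ c
  t≤c n N≤n = ℚ.+-monoʳ-≤ q (ℚ.neg-mono-≤ (proj₂ (proj₂ (archimedean ε 0<ε)) n N≤n))
  tough : ∀ i → Tough t (Member.graph r (size i))
  tough i S = map₂
    (·ℝ-≤-fromℕ (ω (G ∖ S)) {∣ S ∣} t {c} (N , t≤c))
    (Member.tough r (size i) d (ℕ.m≤n⇒m≤n+o i (ℕ.m≤n+m d h)) S)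
    where
    G = Member.graph r (size i)
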